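{- Let $P$ be a polymatroid on $[n]$ with rank function $f$. Then for any $k\in[n]$, $$x^{n-k}y^{k-1}[\mathscr{T}_P(x,y)]=\sum_{S\subset[n],\,|S|=k-1}f(S)+\sum_{S'\subset[n],\,|S'|=k}f(S')-\binom{n}{k-1}f([n])-k\binom{n}{k}.$$
   Context: A polymatroid on $[n]$ is $P=\{\mathbf a\in\mathbb{Z}^n\mid \sum_{i\in I}a_i\le f(I)\ \forall I,\ \sum_{i\in[n]}a_i=f([n])\}$ with $f(\emptyset)=0$, $f$ submodular (rank function). For $\mathbf a\in P$, $i$ is internally active if $\mathbf a-\mathbf e_i+\mathbf e_j\notin P$ for all $j<i$, externally active if $\mathbf a+\mathbf e_i-\mathbf e_j\notin P$ for all $j<i$; $\mathrm{Int}(\mathbf a),\mathrm{Ext}(\mathbf a)$ are these sets. $\mathscr{T}_P(x,y)=\sum_{\mathbf a\in P}x^{|\mathrm{Int}\setminus\mathrm{Ext}|}y^{|\mathrm{Ext}\setminus\mathrm{Int}|}(x+y-1)^{|\mathrm{Int}\cap\mathrm{Ext}|}$. $x^iy^j[g]$ denotes the coefficient of $x^iy^j$ in $g$. -}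

module Defs where

open import Data.Bool using (Bool; true; false; _∧_; _∨_; not; if_then_else_)
open import Data.Nat as ℕ using (ℕ; zero; suc)
open import Data.Fin using (Fin; zero; suc; _<_)
open import Data.Fin.Properties using (_<?_)
open import Data.Fin.Subset using (Subset; ⊤; ⊥; ⁅_⁆; _∪_; _∩_; ∣_∣; _∈_; ∁)
open import Data.Integer as ℤ using (ℤ; +_; _+_; _-_; _*_; -_; _≤ᵇ_; _≤_)
open import Data.Integer.Properties using (_≟_)
open import Data.Vec as Vec using (Vec; []; _∷_; lookup; updateAt; allFin)
open import Data.List as List using (List; []; _∷_; map; concatMap; filterᵇ; upTo; foldr; applyUpTo)
open import Relation.Nullary using (does)
open import Relation.Binary.PropositionalEquality using (_≡_)
open import Data.Nat.Combinatorics using (_C_)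
open import Data.Bool.ListAction using (all; any)

allSubsets : ∀ n → List (Subset n)
allSubsets zero    = [] ∷ []
allSubsets (suc n) = concatMap (λ S → (true ∷ S) ∷ (false ∷ S) ∷ []) (allSubsets n)

sumOverSubsetsOfSize : ∀ {n} → ℕ → (Subset n → ℤ) → ℤ
sumOverSubsetsOfSize {n} k g =
  foldr _+_ (+ 0) (map g (filterᵇ (λ S → does (∣ S ∣ ℕ.≟ k)) (allSubsets n)))

Submodular : ∀ {n} → (Subset n → ℤ) → Set
Submodular f = ∀ A B → f (A ∪ B) + f (A ∩ B) ≤ f A + f B

sumOn : ∀ {n} → Subset n → Vec ℤ n → ℤ
sumOn []          []       = + 0
sumOn (true ∷ I)  (x ∷ a) = x + sumOn I a
sumOn (false ∷ I) (x ∷ a) = sumOn I a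

inP : ∀ {n} → (Subset n → ℤ) → Vec ℤ n → Bool
inP {n} f a =
  all (λ I → sumOn I a ≤ᵇ f I) (allSubsets n) ∧ does (sumOn ⊤ a ≟ f ⊤)

rangeℤ : ℤ → ℤ → List ℤ
rangeℤ lo hi =
  if lo ≤ᵇ hi then map (λ t → lo + + t) (upTo (suc ℤ.∣ hi - lo ∣)) else []

box : ∀ {n} → Vec ℤ n → Vec ℤ n → List (Vec ℤ n)
box []         []         = [] ∷ []
box (l ∷ lo)   (h ∷ hi)   =
  concatMap (λ x → map (x ∷_) (box lo hi)) (rangeℤ l h)

-- Every a ∈ P satisfies f([n]) - f([n]∖{i}) ≤ a_i ≤ f({i}) (from the
-- defining inequalities for I = {i} and I = [n]∖{i}), so P is exactly the
-- set of points of this box passing the membership test.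
pointsOf : ∀ {n} → (Subset n → ℤ) → List (Vec ℤ n)
pointsOf {n} f =
  filterᵇ (inP f)
    (box (Vec.map (λ i → f ⊤ - f (∁ ⁅ i ⁆)) (allFin n))
         (Vec.map (λ i → f ⁅ i ⁆) (allFin n)))

e+ e- : ∀ {n} → Fin n → Vec ℤ n → Vec ℤ n
e+ i a = updateAt a i (λ x → x + + 1)
e- i a = updateAt a i (λ x → x - + 1)

anyBelow : ∀ {n} → Fin n → (Fin n → Bool) → Bool
anyBelow {n} i p = any (λ j → does (j <? i) ∧ p j) (List.allFin n)

intActive : ∀ {n} → (Subset n → ℤ) → Vec ℤ n → Fin n → Bool
intActive f a i = not (anyBelow i (λ j → inP f (e+ j (e- i a))))

extActive : ∀ {n} → (Subset n → ℤ) → Vec ℤ n → Fin n → Bool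
extActive f a i = not (anyBelow i (λ j → inP f (e- j (e+ i a))))

countFin : ∀ {n} → (Fin n → Bool) → ℕ
countFin {n} p = List.length (filterᵇ p (List.allFin n))

-- Bivariate integer polynomials as coefficient functions:
-- p i j = coefficient of x^i y^j.

Poly : Set
Poly = ℕ → ℕ → ℤ

sumTo : ℕ → (ℕ → ℤ) → ℤ
sumTo m g = foldr _+_ (+ 0) (map g (upTo (suc m)))

_⊕_ : Poly → Poly → Poly
(p ⊕ q) i j = p i j + q i j

_⊗_ : Poly → Poly → Poly
(p ⊗ q) i j = sumTo i (λ a → sumTo j (λ b → p a b * q (i ℕ.∸ a) (j ℕ.∸ b)))

monomial : ℤ → ℕ → ℕ → Poly
monomial c a b i j = if does (i ℕ.≟ a) ∧ does (j ℕ.≟ b) then c else + 0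

zeroP oneP X Y : Poly
zeroP = monomial (+ 0) 0 0
oneP  = monomial (+ 1) 0 0
X     = monomial (+ 1) 1 0
Y     = monomial (+ 1) 0 1

_^P_ : Poly → ℕ → Poly
p ^P zero  = oneP
p ^P suc m = p ⊗ (p ^P m)

XY1 : Poly
XY1 = (X ⊕ Y) ⊕ monomial (- + 1) 0 0

coeff : ℕ → ℕ → Poly → ℤ
coeff i j p = p i j

termOf : ∀ {n} → (Subset n → ℤ) → Vec ℤ n → Poly
termOf f a =
  ((X ^P countFin (λ i → intActive f a i ∧ not (extActive f a i)))
   ⊗ (Y ^P countFin (λ i → extActive f a i ∧ not (intActive f a i))))
   ⊗ (XY1 ^P countFin (λ i → intActive f a i ∧ extActive f a i))

𝒯 : ∀ {n} → (Subset n → ℤ) → Poly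
𝒯 f = foldr _⊕_ zeroP (map (termOf f) (pointsOf f))

{-# OPTIONS --safe #-}

-- The points of P with last coordinate t form a polymatroid P_t on [n-1], with
-- rank function f_t(I) = min(f(I), f(I ∪ n) - t), and are nonempty only for
-- t in [m, M], where m = f([n]) - f([n-1]) and M = f({n}).  Whether i < n is
-- active only involves points with the same last coordinate, so it is the same
-- in P and P_t; the index n is internally active iff t = m and externally
-- active iff t = M, because of an exchange property of polymatroids.  Hence
--   T_P = Σ_t ([t = m] x + [t = M] y + 1 - [t = m] - [t = M]) T_{P_t}.
-- By induction T_P has degree n with leading form (x + y)^n, and its part of
-- degree n - 1 is x U(P_m) + y U(P_M) + (M - m - 1)(x + y)^(n-1), where U is
-- that part for n - 1.  As f_m(I) = f(I) and f_M(I) = f(I ∪ n) - M, the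
-- right-hand side of the theorem satisfies the same recursion.
module Submission where

open import Defs
open import Data.Nat using (ℕ; _≤_; _∸_) renaming (_*_ to _*ℕ_)
open import Data.Nat.Combinatorics using (_C_)
open import Data.Integer using (ℤ; +_; _+_; _-_; _*_)
open import Data.Fin.Subset using (Subset; ⊥; ⊤)
open import Relation.Binary.PropositionalEquality using (_≡_)

open import Algebra.Properties.AbelianGroup using (∙-cancelˡ)
open import Algebra.Properties.CommutativeSemigroup using (x∙yz≈y∙xz)
open import Data.Bool using (Bool; true; false; _∧_; _∨_; not)
import Data.Bool.Properties as Bool
open import Data.Bool.ListAction using (all; any)
open import Data.Bool.Properties using (∨-identityʳ; ∧-conicalˡ; ∧-conicalʳ; ¬-not; not-involutive)
open import Data.Fin as Fin using (Fin; zero; suc; inject₁; fromℕ)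
import Data.Fin.Properties as Fin
open import Data.Fin.Properties using (_<?_; toℕ-inject₁; toℕ-fromℕ; toℕ<n)
open import Data.Fin.Subset using (⁅_⁆; _∪_; _∩_; _∈_; _∉_; ∁; ⋃; ∣_∣)
open import Data.Fin.Subset.Properties using
  (_∈?_; ∈⊤; anySubset?; ⊆-antisym; ⊆-max; p⊆p∪q; q⊆p∪q; x∉p⇒x∈∁p;
   ∪-zeroʳ; ∩-identityʳ; ∪-identityʳ; ∩-zeroʳ)
import Data.Integer as ℤ
open import Data.Integer using (-_; _⊓_; _≤ᵇ_; 0ℤ; 1ℤ) renaming (_≤_ to _≤ℤ_)
open import Data.Integer.Properties hiding (_<?_)
open import Data.Integer.Solver using (module +-*-Solver)
open import Data.Integer.Tactic.RingSolver using (solve-∀)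
open import Data.List as List using
  (List; []; _∷_; _++_; map; foldr; length; filterᵇ; concatMap; upTo)
open import Data.List.Membership.Propositional using (find; lose) renaming (_∈_ to _∈ˡ_)
open import Data.List.Membership.Propositional.Properties using
  (∈-allFin; ∈-concatMap⁺; ∈-concatMap⁻; ∈-map⁺; ∈-map⁻; ∈-upTo⁺; ∈-upTo⁻; ∈-filter⁺; ∈-filter⁻)
open import Data.List.Membership.Propositional.Properties.WithK using (unique∧set⇒bag)
open import Data.List.Properties using (map-applyUpTo; map-∘; map-tabulate; length-map; length-upTo)
open import Data.List.Relation.Binary.BagAndSetEquality using (∼bag⇒↭)
import Data.List.Relation.Binary.Permutation.Propositional as Perm
open import Data.List.Relation.Binary.Permutation.Propositional using (_↭_)
import Data.List.Relation.Unary.All as All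
open import Data.List.Relation.Unary.AllPairs using ([]; _∷_)
import Data.List.Relation.Unary.Any as Any
open import Data.List.Relation.Unary.Any using (here; there)
open import Data.List.Relation.Unary.Unique.Propositional using (Unique)
import Data.List.Relation.Unary.Unique.Propositional.Properties as Unique
open import Data.Nat as ℕ using (zero; suc)
open import Data.Nat.Combinatorics using (nCn≡1; k>n⇒nCk≡0; nCk+nC[k+1]≡[n+1]C[k+1])
import Data.Nat.Properties as ℕ
open import Data.Product using (∃; _×_; _,_; proj₁; proj₂)
open import Data.Sum using (inj₁; inj₂)
open import Data.Vec as Vec using (Vec; []; _∷_; _∷ʳ_; here; there; lookup; updateAt; initLast)
import Data.Vec.Properties as Vec
open import Function using (_∘_; Equivalence; mk⇔)
open import Relation.Binary.PropositionalEquality hiding (_≡_)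
open import Relation.Nullary using (¬_; Dec; yes; no; does; contradiction)
open import Relation.Nullary.Decidable using (_×-dec_; dec-true; dec-false; does-⇔)

-- The minimum defining `f_t` has to be resolved only at the two ends. A slice strictly between them
-- enters degree n - 1 only through its leading form, which is the same for all polymatroids on
-- [n-1]. At the ends submodularity settles the minimum: the last element adds at least m and at
-- most M to any set.
--
-- The exchange property rests on tight sets. The slack of a point, f(I) minus the sum of a over I,
-- is nonnegative and submodular, so the sets of slack 0 are closed under union and intersection. If
-- no coordinate could absorb one more unit, every coordinate would lie in a tight set, and the
-- union of these, the whole ground set, would be tight, although the total is one short. Removing a
-- unit is the complementary argument. Integrality turns nonzero slack into slack at least 1. Every
-- other index lies below n, so whichever coordinate is found decides the activity of n.

private
  variable
    n : ℕ
    A B : Set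

-- Finite sums of integers over lists

∑ : ∀ {A : Set} → List A → (A → ℤ) → ℤ
∑ xs g = foldr _+_ 0ℤ (map g xs)

module _ {A : Set} where

  ∑-cong-∈ : ∀ {g h : A → ℤ} xs → (∀ {x} → x ∈ˡ xs → g x ≡ h x) → ∑ xs g ≡ ∑ xs h
  ∑-cong-∈ []       eq = refl
  ∑-cong-∈ (x ∷ xs) eq = cong₂ _+_ (eq (here refl)) (∑-cong-∈ xs (eq ∘ there))

  ∑-cong : ∀ {g h : A → ℤ} xs → (∀ x → g x ≡ h x) → ∑ xs g ≡ ∑ xs h
  ∑-cong xs eq = ∑-cong-∈ xs λ {x} _ → eq x

  ∑-++ : ∀ (g : A → ℤ) xs ys → ∑ (xs ++ ys) g ≡ ∑ xs g + ∑ ys g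
  ∑-++ g []       ys = sym (+-identityˡ _)
  ∑-++ g (x ∷ xs) ys = trans (cong (_+_ (g x)) (∑-++ g xs ys)) (sym (+-assoc (g x) _ _))

  ∑-↭ : ∀ (g : A → ℤ) {xs ys} → xs ↭ ys → ∑ xs g ≡ ∑ ys g
  ∑-↭ g Perm.refl = refl
  ∑-↭ g (Perm.prep x p) = cong (_+_ (g x)) (∑-↭ g p)
  ∑-↭ g (Perm.swap x y p) = trans (cong (λ s → g x + (g y + s)) (∑-↭ g p)) (lemma (g x) (g y) _)
    where
    lemma : ∀ a b c → a + (b + c) ≡ b + (a + c)
    lemma = solve-∀
  ∑-↭ g (Perm.trans p q) = trans (∑-↭ g p) (∑-↭ g q)

  ∑-+ : ∀ (g h : A → ℤ) xs → ∑ xs (λ x → g x + h x) ≡ ∑ xs g + ∑ xs h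
  ∑-+ g h []       = refl
  ∑-+ g h (x ∷ xs) = trans (cong (_+_ (g x + h x)) (∑-+ g h xs)) (lemma (g x) (h x) _ _)
    where
    lemma : ∀ a b c d → a + b + (c + d) ≡ a + c + (b + d)
    lemma = solve-∀

  ∑-*ˡ : ∀ c (g : A → ℤ) xs → ∑ xs (λ x → c * g x) ≡ c * ∑ xs g
  ∑-*ˡ c g []       = sym (*-zeroʳ c)
  ∑-*ˡ c g (x ∷ xs) = trans (cong (_+_ (c * g x)) (∑-*ˡ c g xs)) (sym (*-distribˡ-+ c (g x) _))

  ∑-zero : ∀ xs → ∑ xs (λ (_ : A) → 0ℤ) ≡ 0ℤ
  ∑-zero []       = refl
  ∑-zero (x ∷ xs) = trans (+-identityˡ _) (∑-zero xs)

∑-map : ∀ {A B : Set} (g : B → ℤ) (h : A → B) xs → ∑ (map h xs) g ≡ ∑ xs (g ∘ h)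
∑-map g h xs = cong (foldr _+_ 0ℤ) (sym (map-∘ xs))

∑-concatMap : ∀ {A B : Set} (g : B → ℤ) (h : A → List B) xs →
  ∑ (concatMap h xs) g ≡ ∑ xs (λ x → ∑ (h x) g)
∑-concatMap g h []       = refl
∑-concatMap g h (x ∷ xs) =
  trans (∑-++ g (h x) (concatMap h xs)) (cong (_+_ (∑ (h x) g)) (∑-concatMap g h xs))

∑-const : ∀ {A : Set} c (xs : List A) → ∑ xs (λ _ → c) ≡ + length xs * c
∑-const c []       = refl
∑-const c (x ∷ xs) = trans (cong (_+_ c) (∑-const c xs)) (sym (suc-* (+ length xs) c))

-- Bivariate polynomials

infix 4 _≐_
_≐_ : Poly → Poly → Set
p ≐ q = ∀ i j → p i j ≡ q i j

≐-trans : ∀ {p q r} → p ≐ q → q ≐ r → p ≐ r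
≐-trans e e′ i j = trans (e i j) (e′ i j)

≐-sym : ∀ {p q} → p ≐ q → q ≐ p
≐-sym e i j = sym (e i j)

-- Multiplication by x, y and x + y - 1 as index shifts. `X-⊗`, `Y-⊗` and `XY1-⊗` identify them with
-- the convolutions in `termOf`; afterwards only shifts are handled.
timesX timesY timesXY1 : Poly → Poly
timesX p zero    j = 0ℤ
timesX p (suc i) j = p i j
timesY p i zero    = 0ℤ
timesY p i (suc j) = p i j
timesXY1 p i j = timesX p i j + timesY p i j - p i j

timesX-cong : ∀ {p q} → p ≐ q → timesX p ≐ timesX q
timesX-cong e zero    j = refl
timesX-cong e (suc i) j = e i j

timesY-cong : ∀ {p q} → p ≐ q → timesY p ≐ timesY q
timesY-cong e i zero    = refl
timesY-cong e i (suc j) = e i j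

timesXY1-cong : ∀ {p q} → p ≐ q → timesXY1 p ≐ timesXY1 q
timesXY1-cong e i j = cong₂ _-_ (cong₂ _+_ (timesX-cong e i j) (timesY-cong e i j)) (e i j)

timesX-timesY : ∀ p → timesX (timesY p) ≐ timesY (timesX p)
timesX-timesY p zero    zero    = refl
timesX-timesY p zero    (suc j) = refl
timesX-timesY p (suc i) zero    = refl
timesX-timesY p (suc i) (suc j) = refl

timesX-timesXY1 : ∀ p → timesX (timesXY1 p) ≐ timesXY1 (timesX p)
timesX-timesXY1 p zero    zero    = refl
timesX-timesXY1 p zero    (suc j) = refl
timesX-timesXY1 p (suc i) j       =
  cong (λ z → timesX p i j + z - p i j) (timesX-timesY p (suc i) j)

timesY-timesXY1 : ∀ p → timesY (timesXY1 p) ≐ timesXY1 (timesY p)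
timesY-timesXY1 p zero    zero    = refl
timesY-timesXY1 p (suc i) zero    = refl
timesY-timesXY1 p i       (suc j) =
  cong (λ z → z + timesY p i j - p i j) (sym (timesX-timesY p i (suc j)))

sumTo-suc : ∀ m g → sumTo (suc m) g ≡ g 0 + sumTo m (g ∘ suc)
sumTo-suc m g = cong (λ xs → g 0 + foldr _+_ 0ℤ xs)
  (trans (map-applyUpTo suc g (suc m)) (sym (map-applyUpTo (λ i → i) (g ∘ suc) (suc m))))

sumTo-cong : ∀ {g h} m → (∀ i → g i ≡ h i) → sumTo m g ≡ sumTo m h
sumTo-cong m = ∑-cong (upTo (suc m))

sumTo-zero : ∀ {g} m → (∀ i → g i ≡ 0ℤ) → sumTo m g ≡ 0ℤ
sumTo-zero m e = trans (sumTo-cong m e) (∑-zero (upTo (suc m)))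

⊗-congˡ : ∀ {p q} r → p ≐ q → (p ⊗ r) ≐ (q ⊗ r)
⊗-congˡ r e i j =
  sumTo-cong i λ a → sumTo-cong j λ b → cong (_* r (i ∸ a) (j ∸ b)) (e a b)

⊕-⊗ : ∀ p q r → ((p ⊕ q) ⊗ r) ≐ ((p ⊗ r) ⊕ (q ⊗ r))
⊕-⊗ p q r i j = trans
  (sumTo-cong i λ a → trans
    (sumTo-cong j λ b → *-distribʳ-+ (r (i ∸ a) (j ∸ b)) (p a b) (q a b))
    (∑-+ (summand p a) (summand q a) (upTo (suc j))))
  (∑-+ (λ a → sumTo j (summand p a)) (λ a → sumTo j (summand q a)) (upTo (suc i)))
  where
  summand : Poly → ℕ → ℕ → ℤ
  summand p a b = p a b * r (i ∸ a) (j ∸ b)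

monomial-⊗ : ∀ c q → (monomial c 0 0 ⊗ q) ≐ λ i j → c * q i j
monomial-⊗ c q i j = trans (lemma (λ a → sumTo j (λ b → monomial c 0 0 a b * q (i ∸ a) (j ∸ b))) i
    λ a → sumTo-zero j λ b → *-zeroˡ (q (i ∸ suc a) (j ∸ b)))
  (lemma (λ b → monomial c 0 0 0 b * q i (j ∸ b)) j λ b → *-zeroˡ (q i (j ∸ suc b)))
  where
  lemma : ∀ g m → (∀ a → g (suc a) ≡ 0ℤ) → sumTo m g ≡ g 0
  lemma g zero    e = +-identityʳ (g 0)
  lemma g (suc m) e = trans (sumTo-suc m g)
    (trans (cong (_+_ (g 0)) (sumTo-zero m e)) (+-identityʳ (g 0)))

oneP-⊗ : ∀ q → (oneP ⊗ q) ≐ q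
oneP-⊗ q i j = trans (monomial-⊗ 1ℤ q i j) (*-identityˡ (q i j))

timesX-⊗ : ∀ p q → (timesX p ⊗ q) ≐ timesX (p ⊗ q)
timesX-⊗ p q zero    j = trans (+-identityʳ _) (sumTo-zero j λ b → *-zeroˡ (q 0 (j ∸ b)))
timesX-⊗ p q (suc i) j =
  trans (sumTo-suc i (λ a → sumTo j (λ b → timesX p a b * q (suc i ∸ a) (j ∸ b))))
  (trans (cong (_+ (p ⊗ q) i j) (sumTo-zero j λ b → *-zeroˡ (q (suc i) (j ∸ b))))
         (+-identityˡ _))

timesY-⊗ : ∀ p q → (timesY p ⊗ q) ≐ timesY (p ⊗ q)
timesY-⊗ p q i zero    = sumTo-zero i λ a → trans (+-identityʳ _) (*-zeroˡ (q (i ∸ a) 0))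
timesY-⊗ p q i (suc j) = sumTo-cong i column
  where
  column : ∀ a → sumTo (suc j) (λ b → timesY p a b * q (i ∸ a) (suc j ∸ b)) ≡
                 sumTo j (λ b → p a b * q (i ∸ a) (j ∸ b))
  column a =
    trans (sumTo-suc j (λ b → timesY p a b * q (i ∸ a) (suc j ∸ b)))
    (trans (cong (_+ sumTo j (λ b → p a b * q (i ∸ a) (j ∸ b))) (*-zeroˡ (q (i ∸ a) (suc j))))
           (+-identityˡ _))

X≐ : X ≐ timesX oneP
X≐ zero          j = refl
X≐ (suc zero)    j = refl
X≐ (suc (suc i)) j = refl

Y≐ : Y ≐ timesY oneP
Y≐ zero    zero          = refl
Y≐ (suc i) zero          = refl
Y≐ zero    (suc zero)    = refl
Y≐ zero    (suc (suc j)) = refl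
Y≐ (suc i) (suc j)       = refl

X-⊗ : ∀ q → (X ⊗ q) ≐ timesX q
X-⊗ q = ≐-trans (⊗-congˡ q X≐) (≐-trans (timesX-⊗ oneP q) (timesX-cong (oneP-⊗ q)))

Y-⊗ : ∀ q → (Y ⊗ q) ≐ timesY q
Y-⊗ q = ≐-trans (⊗-congˡ q Y≐) (≐-trans (timesY-⊗ oneP q) (timesY-cong (oneP-⊗ q)))

XY1-⊗ : ∀ q → (XY1 ⊗ q) ≐ timesXY1 q
XY1-⊗ q i j = trans (⊕-⊗ (X ⊕ Y) (monomial (- + 1) 0 0) q i j)
  (cong₂ _+_ (trans (⊕-⊗ X Y q i j) (cong₂ _+_ (X-⊗ q i j) (Y-⊗ q i j)))
             (trans (monomial-⊗ (- + 1) q i j) (-1*i≡-i (q i j))))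

term : ℕ → ℕ → ℕ → Poly
term α β γ = ((X ^P α) ⊗ (Y ^P β)) ⊗ (XY1 ^P γ)

term-unit : ∀ γ → term 0 0 γ ≐ (XY1 ^P γ)
term-unit γ = ≐-trans (⊗-congˡ (XY1 ^P γ) (oneP-⊗ oneP)) (oneP-⊗ (XY1 ^P γ))

term-X : ∀ α β γ → term (suc α) β γ ≐ timesX (term α β γ)
term-X α β γ = ≐-trans
  (⊗-congˡ (XY1 ^P γ) (≐-trans (⊗-congˡ (Y ^P β) (X-⊗ (X ^P α))) (timesX-⊗ (X ^P α) (Y ^P β))))
  (timesX-⊗ ((X ^P α) ⊗ (Y ^P β)) (XY1 ^P γ))

term-0Y : ∀ β γ → term 0 (suc β) γ ≐ timesY (term 0 β γ)
term-0Y β γ = ≐-trans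
  (⊗-congˡ (XY1 ^P γ) (≐-trans (oneP-⊗ (Y ^P suc β))
    (≐-trans (Y-⊗ (Y ^P β)) (timesY-cong (≐-sym (oneP-⊗ (Y ^P β)))))))
  (timesY-⊗ (oneP ⊗ (Y ^P β)) (XY1 ^P γ))

-- Convolutions are expanded from the left, so the powers of x standing in front are peeled off one
-- at a time and restored by commuting the two shifts.
term-Y : ∀ α β γ → term α (suc β) γ ≐ timesY (term α β γ)
term-Y zero    β γ = term-0Y β γ
term-Y (suc α) β γ = ≐-trans (term-X α (suc β) γ) (≐-trans (timesX-cong (term-Y α β γ))
  (≐-trans (timesX-timesY (term α β γ)) (timesY-cong (≐-sym (term-X α β γ)))))

term-XY1 : ∀ α β γ → term α β (suc γ) ≐ timesXY1 (term α β γ)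
term-XY1 zero zero γ = ≐-trans (term-unit (suc γ)) (≐-trans (XY1-⊗ (XY1 ^P γ)) (timesXY1-cong (≐-sym (term-unit γ))))
term-XY1 zero (suc β) γ = ≐-trans (term-0Y β (suc γ)) (≐-trans (timesY-cong (term-XY1 zero β γ))
  (≐-trans (timesY-timesXY1 (term 0 β γ)) (timesXY1-cong (≐-sym (term-0Y β γ)))))
term-XY1 (suc α) β γ = ≐-trans (term-X α β (suc γ)) (≐-trans (timesX-cong (term-XY1 α β γ))
  (≐-trans (timesX-timesXY1 (term α β γ)) (timesXY1-cong (≐-sym (term-X α β γ)))))

bit : Bool → ℕ
bit true  = 1
bit false = 0

⟦_⟧ : Bool → ℤ
⟦ b ⟧ = + bit b

-- The factor of an index whose internal and external activity are p and q:
-- each of x, y, x + y - 1 and 1 is ⟦p⟧x + ⟦q⟧y + (1 - ⟦p⟧ - ⟦q⟧).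
timesActivity : Bool → Bool → Poly → Poly
timesActivity p q P i j =
  ⟦ p ⟧ * timesX P i j + ⟦ q ⟧ * timesY P i j + (1ℤ - ⟦ p ⟧ - ⟦ q ⟧) * P i j

term-activity : ∀ p q α β γ →
  term (bit (p ∧ not q) ℕ.+ α) (bit (q ∧ not p) ℕ.+ β) (bit (p ∧ q) ℕ.+ γ)
    ≐ timesActivity p q (term α β γ)
term-activity true true α β γ i j = trans (term-XY1 α β γ i j)
  (lemma (timesX (term α β γ) i j) (timesY (term α β γ) i j) (term α β γ i j))
  where
  lemma : ∀ x y z → x + y - z ≡ 1ℤ * x + 1ℤ * y + (1ℤ - 1ℤ - 1ℤ) * z
  lemma = solve-∀
term-activity true false α β γ i j = trans (term-X α β γ i j)
  (lemma (timesX (term α β γ) i j) (timesY (term α β γ) i j) (term α β γ i j))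
  where
  lemma : ∀ x y z → x ≡ 1ℤ * x + 0ℤ * y + (1ℤ - 1ℤ - 0ℤ) * z
  lemma = solve-∀
term-activity false true α β γ i j = trans (term-Y α β γ i j)
  (lemma (timesX (term α β γ) i j) (timesY (term α β γ) i j) (term α β γ i j))
  where
  lemma : ∀ x y z → y ≡ 0ℤ * x + 1ℤ * y + (1ℤ - 0ℤ - 1ℤ) * z
  lemma = solve-∀
term-activity false false α β γ i j =
  lemma (timesX (term α β γ) i j) (timesY (term α β γ) i j) (term α β γ i j)
  where
  lemma : ∀ x y z → z ≡ 0ℤ * x + 0ℤ * y + (1ℤ - 0ℤ - 0ℤ) * z
  lemma = solve-∀

-- Exchange in polymatroids

∁-⊥ : ∀ n → ∁ (⊥ {n}) ≡ ⊤
∁-⊥ zero    = refl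
∁-⊥ (suc n) = cong (true ∷_) (∁-⊥ n)

∁-⊤ : ∀ n → ∁ (⊤ {n}) ≡ ⊥
∁-⊤ zero    = refl
∁-⊤ (suc n) = cong (false ∷_) (∁-⊤ n)

∁-involutive : ∀ (I : Subset n) → ∁ (∁ I) ≡ I
∁-involutive []      = refl
∁-involutive (b ∷ I) = cong₂ _∷_ (not-involutive b) (∁-involutive I)

∁-∪ : ∀ (I J : Subset n) → ∁ (I ∪ J) ≡ ∁ I ∩ ∁ J
∁-∪ []          []      = refl
∁-∪ (true ∷ I)  (c ∷ J) = cong (false ∷_) (∁-∪ I J)
∁-∪ (false ∷ I) (c ∷ J) = cong (not c ∷_) (∁-∪ I J)

∁-∩ : ∀ (I J : Subset n) → ∁ (I ∩ J) ≡ ∁ I ∪ ∁ J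
∁-∩ []          []      = refl
∁-∩ (true ∷ I)  (c ∷ J) = cong (not c ∷_) (∁-∩ I J)
∁-∩ (false ∷ I) (c ∷ J) = cong (true ∷_) (∁-∩ I J)

sumOn-⊥ : ∀ (a : Vec ℤ n) → sumOn ⊥ a ≡ 0ℤ
sumOn-⊥ []      = refl
sumOn-⊥ (x ∷ a) = sumOn-⊥ a

sumOn-⁅⁆ : ∀ i (a : Vec ℤ n) → sumOn ⁅ i ⁆ a ≡ lookup a i
sumOn-⁅⁆ zero    (x ∷ a) = trans (cong (_+_ x) (sumOn-⊥ a)) (+-identityʳ x)
sumOn-⁅⁆ (suc i) (x ∷ a) = sumOn-⁅⁆ i a

sumOn-∁ : ∀ I (a : Vec ℤ n) → sumOn I a + sumOn (∁ I) a ≡ sumOn ⊤ a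
sumOn-∁ []          []      = refl
sumOn-∁ (true ∷ I)  (x ∷ a) =
  trans (+-assoc x (sumOn I a) _) (cong (_+_ x) (sumOn-∁ I a))
sumOn-∁ (false ∷ I) (x ∷ a) =
  trans (lemma x (sumOn I a) (sumOn (∁ I) a)) (cong (_+_ x) (sumOn-∁ I a))
  where
  lemma : ∀ x y z → y + (x + z) ≡ x + (y + z)
  lemma = solve-∀

sumOn-∪-∩ : ∀ I J (a : Vec ℤ n) → sumOn (I ∪ J) a + sumOn (I ∩ J) a ≡ sumOn I a + sumOn J a
sumOn-∪-∩ []      []      []      = refl
sumOn-∪-∩ (b ∷ I) (c ∷ J) (x ∷ a) = go b c
  where
  both : ∀ x p q r s → p + q ≡ r + s → x + p + (x + q) ≡ x + r + (x + s)
  both x p q r s e = trans (lemma x p q) (trans (cong (λ z → x + x + z) e) (sym (lemma x r s)))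
    where
    lemma : ∀ x y z → x + y + (x + z) ≡ x + x + (y + z)
    lemma = solve-∀
  left : ∀ x p q r s → p + q ≡ r + s → x + p + q ≡ x + r + s
  left x p q r s e = trans (+-assoc x p q) (trans (cong (_+_ x) e) (sym (+-assoc x r s)))
  right : ∀ x r s → x + r + s ≡ r + (x + s)
  right = solve-∀
  go : ∀ b c → sumOn ((b ∷ I) ∪ (c ∷ J)) (x ∷ a) + sumOn ((b ∷ I) ∩ (c ∷ J)) (x ∷ a)
             ≡ sumOn (b ∷ I) (x ∷ a) + sumOn (c ∷ J) (x ∷ a)
  go true  true  = both x (sumOn (I ∪ J) a) (sumOn (I ∩ J) a) (sumOn I a) (sumOn J a) (sumOn-∪-∩ I J a)
  go true  false = left x (sumOn (I ∪ J) a) (sumOn (I ∩ J) a) (sumOn I a) (sumOn J a) (sumOn-∪-∩ I J a)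
  go false true  = trans
    (left x (sumOn (I ∪ J) a) (sumOn (I ∩ J) a) (sumOn I a) (sumOn J a) (sumOn-∪-∩ I J a))
    (right x (sumOn I a) (sumOn J a))
  go false false = sumOn-∪-∩ I J a

sumOn-updateAt-∈ : ∀ {j} {I : Subset n} (a : Vec ℤ n) c → j ∈ I →
  sumOn I (updateAt a j (_+ c)) ≡ sumOn I a + c
sumOn-updateAt-∈ {I = true ∷ I}  (x ∷ a) c here       = lemma x c (sumOn I a)
  where
  lemma : ∀ x c s → x + c + s ≡ x + s + c
  lemma = solve-∀
sumOn-updateAt-∈ {I = true ∷ I}  (x ∷ a) c (there j∈) =
  trans (cong (_+_ x) (sumOn-updateAt-∈ a c j∈)) (sym (+-assoc x _ c))
sumOn-updateAt-∈ {I = false ∷ I} (x ∷ a) c (there j∈) = sumOn-updateAt-∈ a c j∈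

sumOn-updateAt-∉ : ∀ {j} {I : Subset n} (a : Vec ℤ n) c → j ∉ I →
  sumOn I (updateAt a j (_+ c)) ≡ sumOn I a
sumOn-updateAt-∉ {j = zero}  {true ∷ I}  (x ∷ a) c j∉ = contradiction here j∉
sumOn-updateAt-∉ {j = zero}  {false ∷ I} (x ∷ a) c j∉ = refl
sumOn-updateAt-∉ {j = suc j} {true ∷ I}  (x ∷ a) c j∉ =
  cong (_+_ x) (sumOn-updateAt-∉ a c (j∉ ∘ there))
sumOn-updateAt-∉ {j = suc j} {false ∷ I} (x ∷ a) c j∉ = sumOn-updateAt-∉ a c (j∉ ∘ there)

-- Linear inequalities are proved by exhibiting the difference as a known
-- nonnegative term.
≤-by : ∀ {i j d} → j - i ≡ d → 0ℤ ≤ℤ d → i ≤ℤ j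
≤-by eq 0≤d = 0≤i-j⇒j≤i (subst (0ℤ ≤ℤ_) (sym eq) 0≤d)

∈-⋃ : ∀ {A : Set} {F : A → Subset n} {j x} {xs} → x ∈ˡ xs → j ∈ F x → j ∈ ⋃ (List.map F xs)
∈-⋃ (here refl) j∈ = p⊆p∪q _ j∈
∈-⋃ {F = F} {xs = y ∷ _} (there x∈) j∈ = q⊆p∪q (F y) _ (∈-⋃ x∈ j∈)

⋃-closed : ∀ {A : Set} {F : A → Subset n} (Q : Subset n → Set) → Q ⊥ →
  (∀ {I J} → Q I → Q J → Q (I ∪ J)) → (∀ x → Q (F x)) → ∀ xs → Q (⋃ (List.map F xs))
⋃-closed Q Q⊥ Q∪ QF []       = Q⊥
⋃-closed Q Q⊥ Q∪ QF (x ∷ xs) = Q∪ (QF x) (⋃-closed Q Q⊥ Q∪ QF xs)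

⋃-covering : ∀ {F : Fin n → Subset n} → (∀ j → j ∈ F j) → ⋃ (List.map F (List.allFin n)) ≡ ⊤
⋃-covering covers = ⊆-antisym (⊆-max _) λ {j} _ → ∈-⋃ (∈-allFin j) (covers j)

module _ {d : Subset n → ℤ} (d-nonneg : ∀ I → 0ℤ ≤ℤ d I) (d-submodular : Submodular d) where

  -- Since `d (I ∩ J)` is nonnegative, submodularity squeezes `d (I ∪ J)` between 0 and `d I + d J`.
  zero-∪ : ∀ {I J} → d I ≡ 0ℤ → d J ≡ 0ℤ → d (I ∪ J) ≡ 0ℤ
  zero-∪ {I} {J} dI dJ = ≤-antisym
    (≤-trans (≤-by (lemma (d (I ∪ J)) (d (I ∩ J))) (d-nonneg (I ∩ J)))
      (≤-trans (d-submodular I J) (≤-reflexive (cong₂ _+_ dI dJ))))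
    (d-nonneg (I ∪ J))
    where
    lemma : ∀ x y → x + y - x ≡ y
    lemma = solve-∀

  -- The zero sets of d are closed under union, so if they covered every
  -- element then ⊤ would be one of them.
  uncovered : d ⊥ ≡ 0ℤ → d ⊤ ≢ 0ℤ → ∃ λ j → ∀ I → j ∈ I → d I ≢ 0ℤ
  uncovered d⊥ d⊤ with Fin.all? (λ j → anySubset? λ I → (j ∈? I) ×-dec (d I ≟ 0ℤ))
  ... | yes cover = contradiction
    (subst (λ I → d I ≡ 0ℤ) (⋃-covering (proj₁ ∘ proj₂ ∘ cover))
      (⋃-closed (λ I → d I ≡ 0ℤ) d⊥ zero-∪ (proj₂ ∘ proj₂ ∘ cover) (List.allFin n)))
    d⊤
  ... | no ¬cover with Fin.¬∀⟶∃¬ n _ (λ j → anySubset? λ I → (j ∈? I) ×-dec (d I ≟ 0ℤ)) ¬cover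
  ...   | j , none = j , λ I j∈ dI → none (I , j∈ , dI)

-- Complementation interchanges union and intersection, so `d ∘ ∁` is again submodular and
-- `uncovered` applies to it.
unavoided : ∀ {d : Subset n → ℤ} → (∀ I → 0ℤ ≤ℤ d I) → Submodular d → d ⊤ ≡ 0ℤ → d ⊥ ≢ 0ℤ →
  ∃ λ j → ∀ I → j ∉ I → d I ≢ 0ℤ
unavoided {n} {d} d-nonneg d-submodular d⊤ d⊥
  with uncovered {d = d ∘ ∁} (d-nonneg ∘ ∁) sub (trans (cong d (∁-⊥ n)) d⊤) (d⊥ ∘ trans (sym (cong d (∁-⊤ n))))
  where
  sub : Submodular (d ∘ ∁)
  sub A B rewrite ∁-∪ A B | ∁-∩ A B =
    subst (_≤ℤ d (∁ A) + d (∁ B)) (+-comm (d (∁ A ∪ ∁ B)) _) (d-submodular (∁ A) (∁ B))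
... | j , none = j , λ I j∉ dI → none (∁ I) (x∉p⇒x∈∁p j∉) (trans (cong d (∁-involutive I)) dI)

InP : (Subset n → ℤ) → Vec ℤ n → Set
InP f a = (∀ I → sumOn I a ≤ℤ f I) × sumOn ⊤ a ≡ f ⊤

positive : ∀ {i} → 0ℤ ≤ℤ i → i ≢ 0ℤ → 1ℤ ≤ℤ i
positive 0≤i i≢0 = i<j⇒suc[i]≤j (≤∧≢⇒< 0≤i (i≢0 ∘ sym))

1≢0 : 1ℤ ≢ 0ℤ
1≢0 ()

module _ {g : Subset n → ℤ} (g-submodular : Submodular g) where

  -- The coordinate sum is modular and a constant contributes equally to both sides. The tolerance
  -- `c` is 0 in `exchange-up` and 1 in `exchange-down`.
  slack-submodular : ∀ c (a : Vec ℤ n) → Submodular (λ I → g I + c - sumOn I a)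
  slack-submodular c a A B = ≤-by
    (trans (lemma (g (A ∪ B)) (g (A ∩ B)) (g A) (g B) (sumOn (A ∪ B) a) (sumOn (A ∩ B) a)
                  (sumOn A a) (sumOn B a) c)
           (trans (cong (_+_ (g A + g B - (g (A ∪ B) + g (A ∩ B)))) (i≡j⇒i-j≡0 (sumOn-∪-∩ A B a)))
                  (+-identityʳ _)))
    (i≤j⇒0≤j-i (g-submodular A B))
    where
    lemma : ∀ u i p q u′ i′ p′ q′ c →
      p + c - p′ + (q + c - q′) - (u + c - u′ + (i + c - i′)) ≡ p + q - (u + i) + (u′ + i′ - (p′ + q′))
    lemma = solve 9 (λ u i p q u′ i′ p′ q′ c →
      p :+ c :- p′ :+ (q :+ c :- q′) :- (u :+ c :- u′ :+ (i :+ c :- i′)) :=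
      p :+ q :- (u :+ i) :+ (u′ :+ i′ :- (p′ :+ q′))) refl
      where open +-*-Solver

  -- The slack is 0 on `⊥` and 1 on `⊤`, so some j lies in no tight set. Every set containing j then
  -- has slack at least 1, which leaves room for one more unit at j.
  exchange-up : g ⊥ ≡ 0ℤ → ∀ a → (∀ I → sumOn I a ≤ℤ g I) → sumOn ⊤ a + 1ℤ ≡ g ⊤ →
    ∃ λ j → InP g (e+ j a)
  exchange-up g⊥ a a≤g a⊤ =
    let j , none = uncovered d-nonneg (slack-submodular 0ℤ a)
                     (cong₂ (λ x y → x + 0ℤ - y) g⊥ (sumOn-⊥ a)) (1≢0 ∘ trans (sym d⊤))
    in j , below j none , trans (sumOn-updateAt-∈ a 1ℤ (∈⊤ {x = j})) a⊤
    where
    d : Subset n → ℤ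
    d I = g I + 0ℤ - sumOn I a
    d-nonneg : ∀ I → 0ℤ ≤ℤ d I
    d-nonneg I = i≤j⇒0≤j-i (subst (sumOn I a ≤ℤ_) (sym (+-identityʳ (g I))) (a≤g I))
    d⊤ : d ⊤ ≡ 1ℤ
    d⊤ = trans (cong (λ z → z + 0ℤ - sumOn ⊤ a) (sym a⊤)) (lemma (sumOn ⊤ a))
      where
      lemma : ∀ s → s + 1ℤ + 0ℤ - s ≡ 1ℤ
      lemma = solve-∀
    below : ∀ j → (∀ I → j ∈ I → d I ≢ 0ℤ) → ∀ I → sumOn I (e+ j a) ≤ℤ g I
    below j none I with j ∈? I
    ... | no j∉  = subst (_≤ℤ g I) (sym (sumOn-updateAt-∉ a 1ℤ j∉)) (a≤g I)
    ... | yes j∈ = subst (_≤ℤ g I) (sym (sumOn-updateAt-∈ a 1ℤ j∈))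
      (≤-by (lemma (g I) (sumOn I a)) (i≤j⇒0≤j-i (positive (d-nonneg I) (none I j∈))))
      where
      lemma : ∀ x s → x - (s + 1ℤ) ≡ x + 0ℤ - s - 1ℤ
      lemma = solve-∀

  -- With the tolerance of one unit the slack is 1 on `⊥` and 0 on `⊤`, so some j belongs to every
  -- set of slack 0. These are exactly the sets on which a exceeds g, each by one, and lowering a at
  -- j repairs all of them at once.
  exchange-down : g ⊥ ≡ 0ℤ → ∀ a → (∀ I → sumOn I a ≤ℤ g I + 1ℤ) → sumOn ⊤ a ≡ g ⊤ + 1ℤ →
    ∃ λ j → InP g (e- j a)
  exchange-down g⊥ a a≤g a⊤ =
    let j , none = unavoided d-nonneg (slack-submodular 1ℤ a)
                     (i≡j⇒i-j≡0 (sym a⊤)) (1≢0 ∘ trans (sym d⊥))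
    in j , below j none ,
       trans (sumOn-updateAt-∈ a (- 1ℤ) (∈⊤ {x = j})) (trans (cong (_- 1ℤ) a⊤) (cancel (g ⊤)))
    where
    cancel : ∀ s → s + 1ℤ - 1ℤ ≡ s
    cancel = solve-∀
    d : Subset n → ℤ
    d I = g I + 1ℤ - sumOn I a
    d-nonneg : ∀ I → 0ℤ ≤ℤ d I
    d-nonneg I = i≤j⇒0≤j-i (a≤g I)
    d⊥ : d ⊥ ≡ 1ℤ
    d⊥ = cong₂ (λ x y → x + 1ℤ - y) g⊥ (sumOn-⊥ a)
    below : ∀ j → (∀ I → j ∉ I → d I ≢ 0ℤ) → ∀ I → sumOn I (e- j a) ≤ℤ g I
    below j none I with j ∈? I
    ... | yes j∈ = subst (_≤ℤ g I) (sym (sumOn-updateAt-∈ a (- 1ℤ) j∈))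
      (≤-by (lemma (g I) (sumOn I a)) (d-nonneg I))
      where
      lemma : ∀ x s → x - (s - 1ℤ) ≡ x + 1ℤ - s
      lemma = solve-∀
    ... | no j∉  = subst (_≤ℤ g I) (sym (sumOn-updateAt-∉ a (- 1ℤ) j∉))
      (≤-by (lemma (g I) (sumOn I a)) (i≤j⇒0≤j-i (positive (d-nonneg I) (none I j∉))))
      where
      lemma : ∀ x s → x - s ≡ x + 1ℤ - s - 1ℤ
      lemma = solve-∀

-- Boolean searches, counts and membership tests

∈-allSubsets : ∀ (S : Subset n) → S ∈ˡ allSubsets n
∈-allSubsets []          = here refl
∈-allSubsets (true ∷ S)  = ∈-concatMap⁺ _ (Any.map (λ { refl → here refl }) (∈-allSubsets S))
∈-allSubsets (false ∷ S) = ∈-concatMap⁺ _ (Any.map (λ { refl → there (here refl) }) (∈-allSubsets S))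

all-⁻ : ∀ {p : A → Bool} {x} xs → all p xs ≡ true → x ∈ˡ xs → p x ≡ true
all-⁻ (x ∷ xs) e (here refl) = ∧-conicalˡ _ _ e
all-⁻ {p = p} (x ∷ xs) e (there x∈) = all-⁻ xs (∧-conicalʳ (p x) _ e) x∈

all-⁺ : ∀ {p : A → Bool} xs → (∀ x → p x ≡ true) → all p xs ≡ true
all-⁺ []       e = refl
all-⁺ (x ∷ xs) e = cong₂ _∧_ (e x) (all-⁺ xs e)

any-⁺ : ∀ {p : A → Bool} {x xs} → x ∈ˡ xs → p x ≡ true → any p xs ≡ true
any-⁺ (here refl) e rewrite e = refl
any-⁺ {p = p} {xs = y ∷ _} (there x∈) e = trans (cong (p y ∨_) (any-⁺ x∈ e)) (Bool.∨-zeroʳ (p y))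

any-none : ∀ {p : A → Bool} xs → (∀ x → p x ≡ false) → any p xs ≡ false
any-none []       e = refl
any-none (x ∷ xs) e = cong₂ _∨_ (e x) (any-none xs e)

any-cong : ∀ {p q : A → Bool} xs → (∀ x → p x ≡ q x) → any p xs ≡ any q xs
any-cong []       e = refl
any-cong (x ∷ xs) e = cong₂ _∨_ (e x) (any-cong xs e)

any-++ : ∀ (p : A → Bool) xs ys → any p (xs ++ ys) ≡ any p xs ∨ any p ys
any-++ p []       ys = refl
any-++ p (x ∷ xs) ys = trans (cong (p x ∨_) (any-++ p xs ys)) (sym (Bool.∨-assoc (p x) _ _))

any-map : ∀ {B : Set} (p : B → Bool) (h : A → B) xs → any p (List.map h xs) ≡ any (p ∘ h) xs
any-map p h []       = refl
any-map p h (x ∷ xs) = cong (p (h x) ∨_) (any-map p h xs)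

length-filterᵇ-∷ : ∀ (p : A → Bool) x xs →
  length (filterᵇ p (x ∷ xs)) ≡ bit (p x) ℕ.+ length (filterᵇ p xs)
length-filterᵇ-∷ p x xs with p x
... | true  = refl
... | false = refl

length-filterᵇ-map-∷ʳ : ∀ {B : Set} (p : B → Bool) (h : A → B) y xs →
  length (filterᵇ p (List.map h xs ++ y ∷ [])) ≡ bit (p y) ℕ.+ length (filterᵇ (p ∘ h) xs)
length-filterᵇ-map-∷ʳ p h y []       = length-filterᵇ-∷ p y []
length-filterᵇ-map-∷ʳ p h y (x ∷ xs) =
  trans (length-filterᵇ-∷ p (h x) _)
  (trans (cong (bit (p (h x)) ℕ.+_) (length-filterᵇ-map-∷ʳ p h y xs))
  (trans (x∙yz≈y∙xz ℕ.+-commutativeSemigroup (bit (p (h x))) (bit (p y)) _)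
         (cong (bit (p y) ℕ.+_) (sym (length-filterᵇ-∷ (p ∘ h) x xs)))))

length-filterᵇ-cong : ∀ {p q : A → Bool} xs → (∀ x → p x ≡ q x) →
  length (filterᵇ p xs) ≡ length (filterᵇ q xs)
length-filterᵇ-cong []       e = refl
length-filterᵇ-cong {p = p} {q} (x ∷ xs) e =
  trans (length-filterᵇ-∷ p x xs)
  (trans (cong₂ (λ b c → bit b ℕ.+ c) (e x) (length-filterᵇ-cong xs e))
         (sym (length-filterᵇ-∷ q x xs)))

allFin-∷ʳ : ∀ n → List.allFin (suc n) ≡ List.map inject₁ (List.allFin n) ++ fromℕ n ∷ []
allFin-∷ʳ n = trans (tabulate-∷ʳ n (λ i → i)) (cong (_++ fromℕ n ∷ []) (sym (map-tabulate (λ i → i) inject₁)))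
  where
  tabulate-∷ʳ : ∀ n (h : Fin (suc n) → A) →
    List.tabulate h ≡ List.tabulate (h ∘ inject₁) ++ h (fromℕ n) ∷ []
  tabulate-∷ʳ zero    h = refl
  tabulate-∷ʳ (suc n) h = cong (h zero ∷_) (tabulate-∷ʳ n (h ∘ suc))

countFin-last : ∀ (p : Fin (suc n) → Bool) →
  countFin p ≡ bit (p (fromℕ n)) ℕ.+ countFin (p ∘ inject₁)
countFin-last {n} p = trans (cong (length ∘ filterᵇ p) (allFin-∷ʳ n))
  (length-filterᵇ-map-∷ʳ p inject₁ (fromℕ n) (List.allFin n))

anyBelow-cong : ∀ (i : Fin n) {p q} → (∀ j → p j ≡ q j) → anyBelow i p ≡ anyBelow i q
anyBelow-cong {n} i e = any-cong (List.allFin n) λ j → cong (does (j <? i) ∧_) (e j)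

any-allFin-last : ∀ (p : Fin (suc n) → Bool) → p (fromℕ n) ≡ false →
  any p (List.allFin (suc n)) ≡ any (p ∘ inject₁) (List.allFin n)
any-allFin-last {n} p e = trans (cong (any p) (allFin-∷ʳ n))
  (trans (any-++ p (List.map inject₁ (List.allFin n)) _)
  (trans (cong₂ _∨_ (any-map p inject₁ (List.allFin n)) (cong (_∨ false) e)) (∨-identityʳ _)))

-- The last index is never below `inject₁ i`, so it drops out of the search; this is why removing
-- the largest index preserves the other activities.
anyBelow-inject₁ : ∀ (i : Fin n) p → anyBelow (inject₁ i) p ≡ anyBelow i (p ∘ inject₁)
anyBelow-inject₁ {n} i p = trans
  (any-allFin-last (λ j → does (j <? inject₁ i) ∧ p j)
    (cong (_∧ p (fromℕ n)) (dec-false (fromℕ n <? inject₁ i)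
      (ℕ.≤⇒≯ (subst₂ ℕ._≤_ (sym (toℕ-inject₁ i)) (sym (toℕ-fromℕ n)) (ℕ.<⇒≤ (toℕ<n i)))))))
  (any-cong (List.allFin n) λ j → cong (_∧ p (inject₁ j))
    (does-⇔ (mk⇔ (subst₂ ℕ._<_ (toℕ-inject₁ j) (toℕ-inject₁ i))
                 (subst₂ ℕ._<_ (sym (toℕ-inject₁ j)) (sym (toℕ-inject₁ i))))
            (inject₁ j <? inject₁ i) (j <? i)))

anyBelow-last : ∀ (p : Fin (suc n) → Bool) →
  anyBelow (fromℕ n) p ≡ any (p ∘ inject₁) (List.allFin n)
anyBelow-last {n} p = trans
  (any-allFin-last (λ j → does (j <? fromℕ n) ∧ p j)
    (cong (_∧ p (fromℕ n)) (dec-false (fromℕ n <? fromℕ n) (ℕ.<-irrefl refl))))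
  (any-cong (List.allFin n) λ j → cong (_∧ p (inject₁ j))
    (dec-true (inject₁ j <? fromℕ n)
      (subst₂ ℕ._<_ (sym (toℕ-inject₁ j)) (sym (toℕ-fromℕ n)) (toℕ<n j))))

inP⇒InP : ∀ {f : Subset n → ℤ} {a} → inP f a ≡ true → InP f a
inP⇒InP {n} {f} {a} e =
    (λ I → ≤ᵇ⇒≤ (Equivalence.from Bool.T-≡ (all-⁻ (allSubsets n) (∧-conicalˡ _ _ e) (∈-allSubsets I))))
  , total (sumOn ⊤ a ≟ f ⊤) (∧-conicalʳ (all (λ I → sumOn I a ≤ᵇ f I) (allSubsets n)) _ e)
  where
  total : ∀ (d : Dec (sumOn ⊤ a ≡ f ⊤)) → does d ≡ true → sumOn ⊤ a ≡ f ⊤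
  total (yes eq) _ = eq

InP⇒inP : ∀ {f : Subset n → ℤ} {a} → InP f a → inP f a ≡ true
InP⇒inP {n} {f} {a} (below , total) = cong₂ _∧_
  (all-⁺ (allSubsets n) λ I → Equivalence.to Bool.T-≡ (≤⇒≤ᵇ (below I)))
  (dec-true (sumOn ⊤ a ≟ f ⊤) total)

¬InP⇒inP : ∀ {f : Subset n → ℤ} {a} → ¬ InP f a → inP f a ≡ false
¬InP⇒inP ¬p = ¬-not (¬p ∘ inP⇒InP)

-- The largest index is the last one, so subsets and points are split at the
-- end of the vector.

∷ʳ-elim : ∀ {B : Set} (Q : Vec B (suc n) → Set) → (∀ I b → Q (I ∷ʳ b)) → ∀ I → Q I
∷ʳ-elim Q h I with initLast I
... | J , b , refl = h J b

⊤-∷ʳ : ∀ n → ⊤ {suc n} ≡ ⊤ ∷ʳ true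
⊤-∷ʳ zero    = refl
⊤-∷ʳ (suc n) = cong (true ∷_) (⊤-∷ʳ n)

⊥-∷ʳ : ∀ n → ⊥ {suc n} ≡ ⊥ ∷ʳ false
⊥-∷ʳ zero    = refl
⊥-∷ʳ (suc n) = cong (false ∷_) (⊥-∷ʳ n)

∪-∷ʳ : ∀ (I J : Subset n) b c → (I ∷ʳ b) ∪ (J ∷ʳ c) ≡ (I ∪ J) ∷ʳ (b ∨ c)
∪-∷ʳ []      []      b c = refl
∪-∷ʳ (x ∷ I) (y ∷ J) b c = cong ((x ∨ y) ∷_) (∪-∷ʳ I J b c)

∩-∷ʳ : ∀ (I J : Subset n) b c → (I ∷ʳ b) ∩ (J ∷ʳ c) ≡ (I ∩ J) ∷ʳ (b ∧ c)
∩-∷ʳ []      []      b c = refl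
∩-∷ʳ (x ∷ I) (y ∷ J) b c = cong ((x ∧ y) ∷_) (∩-∷ʳ I J b c)

sumOn-∷ʳ-false : ∀ I (a : Vec ℤ n) t → sumOn (I ∷ʳ false) (a ∷ʳ t) ≡ sumOn I a
sumOn-∷ʳ-false []          []      t = refl
sumOn-∷ʳ-false (true ∷ I)  (x ∷ a) t = cong (_+_ x) (sumOn-∷ʳ-false I a t)
sumOn-∷ʳ-false (false ∷ I) (x ∷ a) t = sumOn-∷ʳ-false I a t

sumOn-∷ʳ-true : ∀ I (a : Vec ℤ n) t → sumOn (I ∷ʳ true) (a ∷ʳ t) ≡ sumOn I a + t
sumOn-∷ʳ-true []          []      t = +-comm t 0ℤ
sumOn-∷ʳ-true (true ∷ I)  (x ∷ a) t =
  trans (cong (_+_ x) (sumOn-∷ʳ-true I a t)) (sym (+-assoc x _ t))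
sumOn-∷ʳ-true (false ∷ I) (x ∷ a) t = sumOn-∷ʳ-true I a t

updateAt-inject₁-∷ʳ : ∀ i {h : ℤ → ℤ} (a : Vec ℤ n) t →
  updateAt (a ∷ʳ t) (inject₁ i) h ≡ updateAt a i h ∷ʳ t
updateAt-inject₁-∷ʳ zero    (x ∷ a) t = refl
updateAt-inject₁-∷ʳ (suc i) (x ∷ a) t = cong (x ∷_) (updateAt-inject₁-∷ʳ i a t)

updateAt-last-∷ʳ : ∀ {h : ℤ → ℤ} (a : Vec ℤ n) t → updateAt (a ∷ʳ t) (fromℕ n) h ≡ a ∷ʳ h t
updateAt-last-∷ʳ []      t = refl
updateAt-last-∷ʳ (x ∷ a) t = cong (x ∷_) (updateAt-last-∷ʳ a t)

-- Slices of a polymatroid by its last coordinate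

lowest highest : (Subset (suc n) → ℤ) → ℤ
lowest  f = f (⊤ ∷ʳ true) - f (⊤ ∷ʳ false)
highest f = f (⊥ ∷ʳ true)

-- The rank function of the polymatroid of points of P with last coordinate t.
slice : (Subset (suc n) → ℤ) → ℤ → Subset n → ℤ
slice f t I = f (I ∷ʳ false) ⊓ (f (I ∷ʳ true) - t)

slice-≤-false : ∀ (f : Subset (suc n) → ℤ) t I → slice f t I ≤ℤ f (I ∷ʳ false)
slice-≤-false f t I = i⊓j≤i (f (I ∷ʳ false)) (f (I ∷ʳ true) - t)

slice-≤-true : ∀ (f : Subset (suc n) → ℤ) t I → slice f t I ≤ℤ f (I ∷ʳ true) - t
slice-≤-true f t I = i⊓j≤j (f (I ∷ʳ false)) (f (I ∷ʳ true) - t)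

slice-⊤ : ∀ (f : Subset (suc n) → ℤ) {t} → lowest f ≤ℤ t → slice f t ⊤ ≡ f (⊤ ∷ʳ true) - t
slice-⊤ f {t} lo = i≥j⇒i⊓j≡j (≤-by (lemma (f (⊤ ∷ʳ true)) (f (⊤ ∷ʳ false)) t) (i≤j⇒0≤j-i lo))
  where
  lemma : ∀ x y t → y - (x - t) ≡ t - (x - y)
  lemma = solve-∀

-- Together with `slice-suc` this measures a point of one slice against the rank functions of the
-- two neighbouring slices, as `exchange-up` and `exchange-down` require.
slice-mono : ∀ (f : Subset (suc n) → ℤ) {s t} → s ≤ℤ t → ∀ I → slice f t I ≤ℤ slice f s I
slice-mono f {s} {t} s≤t I =
  ⊓-monoʳ-≤ (f (I ∷ʳ false)) (+-monoʳ-≤ (f (I ∷ʳ true)) (neg-mono-≤ s≤t))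

-- Only the second argument of the minimum depends on t, and it drops by one when t grows by one.
slice-suc : ∀ (f : Subset (suc n) → ℤ) t I → slice f t I ≤ℤ slice f (t + 1ℤ) I + 1ℤ
slice-suc f t I with ⊓-sel (f (I ∷ʳ false)) (f (I ∷ʳ true) - (t + 1ℤ))
... | inj₁ e rewrite e = ≤-trans (slice-≤-false f t I) (≤-by (lemma (f (I ∷ʳ false))) 0≤1)
  where
  lemma : ∀ x → x + 1ℤ - x ≡ 1ℤ
  lemma = solve-∀
  0≤1 : 0ℤ ≤ℤ 1ℤ
  0≤1 = ℤ.+≤+ ℕ.z≤n
... | inj₂ e rewrite e = ≤-trans (slice-≤-true f t I) (≤-reflexive (lemma (f (I ∷ʳ true)) t))
  where
  lemma : ∀ x t → x - t ≡ x - (t + 1ℤ) + 1ℤ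
  lemma = solve-∀

t≰t-1 : ∀ {t} → ¬ t ≤ℤ t - 1ℤ
t≰t-1 {t} le = <-irrefl refl (i≤pred[j]⇒i<j (subst (t ≤ℤ_) (+-comm t (- 1ℤ)) le))

t+1≰t : ∀ {t} → ¬ t + 1ℤ ≤ℤ t
t+1≰t {t} le = <-irrefl refl (suc[i]≤j⇒i<j (subst (_≤ℤ t) (+-comm t 1ℤ) le))

module Slice {n} (f : Subset (suc n) → ℤ) (f⊥ : f ⊥ ≡ 0ℤ) (f-submodular : Submodular f) where

  submodular-∷ʳ : ∀ I J b c →
    f ((I ∪ J) ∷ʳ (b ∨ c)) + f ((I ∩ J) ∷ʳ (b ∧ c)) ≤ℤ f (I ∷ʳ b) + f (J ∷ʳ c)
  submodular-∷ʳ I J b c =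
    subst₂ (λ U V → f U + f V ≤ℤ f (I ∷ʳ b) + f (J ∷ʳ c)) (∪-∷ʳ I J b c) (∩-∷ʳ I J b c)
      (f-submodular (I ∷ʳ b) (J ∷ʳ c))

  f⊥false : f (⊥ ∷ʳ false) ≡ 0ℤ
  f⊥false = trans (cong f (sym (⊥-∷ʳ n))) f⊥

  slice-⊥ : ∀ {t} → t ≤ℤ highest f → slice f t ⊥ ≡ 0ℤ
  slice-⊥ {t} hi = trans (i≤j⇒i⊓j≡i (subst (_≤ℤ highest f - t) (sym f⊥false) (i≤j⇒0≤j-i hi))) f⊥false

  -- The cases record which argument attains the minimum at A and at B, that is, whether the last
  -- element is joined to each. Submodularity of f for the sets so extended then bounds the sum. In
  -- the mixed cases the union receives the last element and the intersection does not, so t is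
  -- subtracted once on either side.
  slice-submodular : ∀ t → Submodular (slice f t)
  slice-submodular t A B
    with ⊓-sel (f (A ∷ʳ false)) (f (A ∷ʳ true) - t) | ⊓-sel (f (B ∷ʳ false)) (f (B ∷ʳ true) - t)
  ... | inj₁ a | inj₁ b rewrite a | b =
    ≤-trans (+-mono-≤ (slice-≤-false f t (A ∪ B)) (slice-≤-false f t (A ∩ B)))
            (submodular-∷ʳ A B false false)
  ... | inj₁ a | inj₂ b rewrite a | b =
    ≤-trans (+-mono-≤ (slice-≤-true f t (A ∪ B)) (slice-≤-false f t (A ∩ B)))
      (≤-by (lemma (f ((A ∪ B) ∷ʳ true)) (f ((A ∩ B) ∷ʳ false)) (f (A ∷ʳ false)) (f (B ∷ʳ true)) t)
            (i≤j⇒0≤j-i (submodular-∷ʳ A B false true)))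
    where
    lemma : ∀ u i p q t → p + (q - t) - (u - t + i) ≡ p + q - (u + i)
    lemma = solve-∀
  ... | inj₂ a | inj₁ b rewrite a | b =
    ≤-trans (+-mono-≤ (slice-≤-true f t (A ∪ B)) (slice-≤-false f t (A ∩ B)))
      (≤-by (lemma (f ((A ∪ B) ∷ʳ true)) (f ((A ∩ B) ∷ʳ false)) (f (A ∷ʳ true)) (f (B ∷ʳ false)) t)
            (i≤j⇒0≤j-i (submodular-∷ʳ A B true false)))
    where
    lemma : ∀ u i p q t → p - t + q - (u - t + i) ≡ p + q - (u + i)
    lemma = solve-∀
  ... | inj₂ a | inj₂ b rewrite a | b =
    ≤-trans (+-mono-≤ (slice-≤-true f t (A ∪ B)) (slice-≤-true f t (A ∩ B)))
      (≤-by (lemma (f ((A ∪ B) ∷ʳ true)) (f ((A ∩ B) ∷ʳ true)) (f (A ∷ʳ true)) (f (B ∷ʳ true)) t)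
            (i≤j⇒0≤j-i (submodular-∷ʳ A B true true)))
    where
    lemma : ∀ u i p q t → p - t + (q - t) - (u - t + (i - t)) ≡ p + q - (u + i)
    lemma = solve-∀

  -- Submodularity for the set of all earlier elements and the singleton of the last one, which are
  -- disjoint and cover everything.
  lowest≤highest : lowest f ≤ℤ highest f
  lowest≤highest = ≤-by (lemma (f (⊤ ∷ʳ true)) (f (⊤ ∷ʳ false)) (f (⊥ ∷ʳ true)))
    (i≤j⇒0≤j-i (subst₂ (λ U V → U + V ≤ℤ f (⊤ ∷ʳ false) + f (⊥ ∷ʳ true))
      (cong (λ U → f (U ∷ʳ true)) (∪-identityʳ ⊤))
      (trans (cong (λ U → f (U ∷ʳ false)) (∩-zeroʳ ⊤)) f⊥false)
      (submodular-∷ʳ ⊤ ⊥ false true)))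
    where
    lemma : ∀ x y z → z - (x - y) ≡ y + z - (x + 0ℤ)
    lemma = solve-∀

  -- Diminishing returns: the last element adds to I at least what it adds to the set of all earlier
  -- elements, which is `lowest f`.
  slice-lowest : ∀ I → slice f (lowest f) I ≡ f (I ∷ʳ false)
  slice-lowest I = i≤j⇒i⊓j≡i (≤-by
    (lemma (f (I ∷ʳ true)) (f (I ∷ʳ false)) (f (⊤ ∷ʳ true)) (f (⊤ ∷ʳ false)))
    (i≤j⇒0≤j-i (subst₂ (λ U V → f (U ∷ʳ true) + f (V ∷ʳ false) ≤ℤ f (I ∷ʳ true) + f (⊤ ∷ʳ false))
      (∪-zeroʳ I) (∩-identityʳ I) (submodular-∷ʳ I ⊤ true false))))
    where
    lemma : ∀ x y u v → x - (u - v) - y ≡ x + v - (u + y)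
    lemma = solve-∀

  -- Diminishing returns again: the last element adds to I at most what it adds to the empty set,
  -- which is `highest f`.
  slice-highest : ∀ I → slice f (highest f) I ≡ f (I ∷ʳ true) - highest f
  slice-highest I = i≥j⇒i⊓j≡j (≤-by
    (lemma (f (I ∷ʳ true)) (f (I ∷ʳ false)) (highest f))
    (i≤j⇒0≤j-i (subst₂ (λ U V → U + V ≤ℤ f (I ∷ʳ false) + f (⊥ ∷ʳ true))
      (cong (λ U → f (U ∷ʳ true)) (∪-identityʳ I))
      (trans (cong (λ U → f (U ∷ʳ false)) (∩-zeroʳ I)) f⊥false)
      (submodular-∷ʳ I ⊥ false true))))
    where
    lemma : ∀ x y h → y - (x - h) ≡ y + h - (x + 0ℤ)
    lemma = solve-∀

  InP-bounds : ∀ {a t} → InP f (a ∷ʳ t) → lowest f ≤ℤ t × t ≤ℤ highest f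
  InP-bounds {a} {t} (below , total) =
      ≤-by (lemma (f (⊤ ∷ʳ true)) (f (⊤ ∷ʳ false)) (sumOn ⊤ a) t e)
        (i≤j⇒0≤j-i (subst (_≤ℤ f (⊤ ∷ʳ false)) (sumOn-∷ʳ-false ⊤ a t) (below (⊤ ∷ʳ false))))
    , subst (_≤ℤ highest f)
        (trans (sumOn-∷ʳ-true ⊥ a t) (trans (cong (_+ t) (sumOn-⊥ a)) (+-identityˡ t)))
        (below (⊥ ∷ʳ true))
    where
    e : sumOn ⊤ a + t ≡ f (⊤ ∷ʳ true)
    e = trans (sym (sumOn-∷ʳ-true ⊤ a t)) (subst (λ I → sumOn I (a ∷ʳ t) ≡ f I) (⊤-∷ʳ n) total)
    lemma : ∀ x y s t → s + t ≡ x → t - (x - y) ≡ y - s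
    lemma x y s t refl = identity s t y
      where
      identity : ∀ s t y → t - (s + t - y) ≡ y - s
      identity = solve-∀

  -- Each I constrains a twice, once alone and once joined with the last element, where t moves to
  -- the right-hand side; the minimum combines the two.
  InP-slice⁺ : ∀ {a t} → InP f (a ∷ʳ t) → InP (slice f t) a
  InP-slice⁺ {a} {t} p@(below , total) =
      (λ I → ⊓-glb
        (subst (_≤ℤ f (I ∷ʳ false)) (sumOn-∷ʳ-false I a t) (below (I ∷ʳ false)))
        (≤-by (lemma (f (I ∷ʳ true)) (sumOn I a) t)
          (i≤j⇒0≤j-i (subst (_≤ℤ f (I ∷ʳ true)) (sumOn-∷ʳ-true I a t) (below (I ∷ʳ true))))))
    , trans (sym (cancel (sumOn ⊤ a) t))
        (trans (cong (_- t) (trans (sym (sumOn-∷ʳ-true ⊤ a t))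
                                   (subst (λ I → sumOn I (a ∷ʳ t) ≡ f I) (⊤-∷ʳ n) total)))
               (sym (slice-⊤ f (proj₁ (InP-bounds p)))))
    where
    lemma : ∀ x s t → x - t - s ≡ x - (s + t)
    lemma = solve-∀
    cancel : ∀ s t → s + t - t ≡ s
    cancel = solve-∀

  -- The lower bound on t makes the second argument the minimum at `⊤`, so the total of the slice
  -- becomes the total of P after adding t.
  InP-slice⁻ : ∀ {a t} → lowest f ≤ℤ t → InP (slice f t) a → InP f (a ∷ʳ t)
  InP-slice⁻ {a} {t} lo (below , total) =
      ∷ʳ-elim (λ I → sumOn I (a ∷ʳ t) ≤ℤ f I) below′
    , subst (λ I → sumOn I (a ∷ʳ t) ≡ f I) (sym (⊤-∷ʳ n))
        (trans (sumOn-∷ʳ-true ⊤ a t)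
          (trans (cong (_+ t) (trans total (slice-⊤ f lo))) (cancel (f (⊤ ∷ʳ true)) t)))
    where
    cancel : ∀ s t → s - t + t ≡ s
    cancel = solve-∀
    lemma : ∀ x s t → x - (s + t) ≡ x - t - s
    lemma = solve-∀
    below′ : ∀ I b → sumOn (I ∷ʳ b) (a ∷ʳ t) ≤ℤ f (I ∷ʳ b)
    below′ I false = subst (_≤ℤ f (I ∷ʳ false)) (sym (sumOn-∷ʳ-false I a t))
      (≤-trans (below I) (slice-≤-false f t I))
    below′ I true  = subst (_≤ℤ f (I ∷ʳ true)) (sym (sumOn-∷ʳ-true I a t))
      (≤-by (lemma (f (I ∷ʳ true)) (sumOn I a) t)
        (i≤j⇒0≤j-i (≤-trans (below I) (slice-≤-true f t I))))

  inP-slice : ∀ a {t} → lowest f ≤ℤ t → inP f (a ∷ʳ t) ≡ inP (slice f t) a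
  inP-slice a {t} lo with inP (slice f t) a in e
  ... | true  = InP⇒inP (InP-slice⁻ lo (inP⇒InP e))
  ... | false = ¬InP⇒inP λ p → false≢true (trans (sym e) (InP⇒inP (InP-slice⁺ p)))
    where
    false≢true : false ≢ true
    false≢true ()

  intActive-inject₁ : ∀ a {t} → lowest f ≤ℤ t → ∀ i →
    intActive f (a ∷ʳ t) (inject₁ i) ≡ intActive (slice f t) a i
  intActive-inject₁ a {t} lo i = cong not (trans
    (anyBelow-inject₁ i λ j → inP f (e+ j (e- (inject₁ i) (a ∷ʳ t))))
    (anyBelow-cong i λ j → trans
      (cong (inP f) (trans (cong (e+ (inject₁ j)) (updateAt-inject₁-∷ʳ i a t))
                           (updateAt-inject₁-∷ʳ j (e- i a) t)))
      (inP-slice (e+ j (e- i a)) lo)))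

  extActive-inject₁ : ∀ a {t} → lowest f ≤ℤ t → ∀ i →
    extActive f (a ∷ʳ t) (inject₁ i) ≡ extActive (slice f t) a i
  extActive-inject₁ a {t} lo i = cong not (trans
    (anyBelow-inject₁ i λ j → inP f (e- j (e+ (inject₁ i) (a ∷ʳ t))))
    (anyBelow-cong i λ j → trans
      (cong (inP f) (trans (cong (e- (inject₁ j)) (updateAt-inject₁-∷ʳ i a t))
                           (updateAt-inject₁-∷ʳ j (e+ i a) t)))
      (inP-slice (e- j (e+ i a)) lo)))

  -- At `lowest f` no point has last coordinate t - 1. Above it the slice at t - 1 is within range,
  -- and a satisfies its inequalities but has a total one short; `exchange-up` supplies the
  -- coordinate that takes the unit.
  intActive-last : ∀ {a t} → InP f (a ∷ʳ t) →
    intActive f (a ∷ʳ t) (fromℕ n) ≡ does (t ≟ lowest f)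
  intActive-last {a} {t} p = trans
    (cong not (trans (anyBelow-last λ j → inP f (e+ j (e- (fromℕ n) (a ∷ʳ t))))
                     (any-cong (List.allFin n) moved)))
    (go (t ≟ lowest f))
    where
    lo = proj₁ (InP-bounds p)
    hi = proj₂ (InP-bounds p)
    moved : ∀ j → inP f (e+ (inject₁ j) (e- (fromℕ n) (a ∷ʳ t))) ≡ inP f (e+ j a ∷ʳ (t - 1ℤ))
    moved j = cong (inP f) (trans (cong (e+ (inject₁ j)) (updateAt-last-∷ʳ a t))
                                  (updateAt-inject₁-∷ʳ j a (t - 1ℤ)))
    go : ∀ (d : Dec (t ≡ lowest f)) →
      not (any (λ j → inP f (e+ j a ∷ʳ (t - 1ℤ))) (List.allFin n)) ≡ does d
    go (yes refl) = cong not (any-none (List.allFin n) λ j → ¬InP⇒inP (t≰t-1 ∘ proj₁ ∘ InP-bounds))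
    go (no t≢lo) =
      let j , p′ = exchange-up (slice-submodular (t - 1ℤ)) (slice-⊥ (≤-trans t-1≤t hi)) a
                     (λ I → ≤-trans (proj₁ (InP-slice⁺ p) I) (slice-mono f t-1≤t I)) total
      in cong not (any-⁺ (∈-allFin j) (InP⇒inP (InP-slice⁻ lo′ p′)))
      where
      t-1≤t : t - 1ℤ ≤ℤ t
      t-1≤t = i-j≤i t 1ℤ
      lo′ : lowest f ≤ℤ t - 1ℤ
      lo′ = subst (lowest f ≤ℤ_) (+-comm (- 1ℤ) t) (i<j⇒i≤pred[j] (≤∧≢⇒< lo (t≢lo ∘ sym)))
      total : sumOn ⊤ a + 1ℤ ≡ slice f (t - 1ℤ) ⊤
      total = trans (cong (_+ 1ℤ) (trans (proj₂ (InP-slice⁺ p)) (slice-⊤ f lo)))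
        (trans (lemma (f (⊤ ∷ʳ true)) t) (sym (slice-⊤ f lo′)))
        where
        lemma : ∀ x t → x - t + 1ℤ ≡ x - (t - 1ℤ)
        lemma = solve-∀

  -- At `highest f` no point has last coordinate t + 1. Below it a has one unit too many for the
  -- slice at t + 1 and exceeds no bound there by more than one; `exchange-down` finds the
  -- coordinate that gives the unit up.
  extActive-last : ∀ {a t} → InP f (a ∷ʳ t) →
    extActive f (a ∷ʳ t) (fromℕ n) ≡ does (t ≟ highest f)
  extActive-last {a} {t} p = trans
    (cong not (trans (anyBelow-last λ j → inP f (e- j (e+ (fromℕ n) (a ∷ʳ t))))
                     (any-cong (List.allFin n) moved)))
    (go (t ≟ highest f))
    where
    lo = proj₁ (InP-bounds p)
    hi = proj₂ (InP-bounds p)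
    moved : ∀ j → inP f (e- (inject₁ j) (e+ (fromℕ n) (a ∷ʳ t))) ≡ inP f (e- j a ∷ʳ (t + 1ℤ))
    moved j = cong (inP f) (trans (cong (e- (inject₁ j)) (updateAt-last-∷ʳ a t))
                                  (updateAt-inject₁-∷ʳ j a (t + 1ℤ)))
    go : ∀ (d : Dec (t ≡ highest f)) →
      not (any (λ j → inP f (e- j a ∷ʳ (t + 1ℤ))) (List.allFin n)) ≡ does d
    go (yes refl) = cong not (any-none (List.allFin n) λ j → ¬InP⇒inP (t+1≰t ∘ proj₂ ∘ InP-bounds))
    go (no t≢hi) =
      let j , p′ = exchange-down (slice-submodular (t + 1ℤ)) (slice-⊥ hi′) a
                     (λ I → ≤-trans (proj₁ (InP-slice⁺ p) I) (slice-suc f t I)) total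
      in cong not (any-⁺ (∈-allFin j) (InP⇒inP (InP-slice⁻ lo′ p′)))
      where
      lo′ : lowest f ≤ℤ t + 1ℤ
      lo′ = ≤-trans lo (i≤i+j t 1ℤ)
      hi′ : t + 1ℤ ≤ℤ highest f
      hi′ = subst (_≤ℤ highest f) (+-comm 1ℤ t) (i<j⇒suc[i]≤j (≤∧≢⇒< hi t≢hi))
      total : sumOn ⊤ a ≡ slice f (t + 1ℤ) ⊤ + 1ℤ
      total = trans (trans (proj₂ (InP-slice⁺ p)) (slice-⊤ f lo))
        (trans (lemma (f (⊤ ∷ʳ true)) t) (cong (_+ 1ℤ) (sym (slice-⊤ f lo′))))
        where
        lemma : ∀ x t → x - t ≡ x - (t + 1ℤ) + 1ℤ
        lemma = solve-∀

  termOf-∷ʳ : ∀ {a t} → InP f (a ∷ʳ t) →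
    termOf f (a ∷ʳ t) ≐
      timesActivity (does (t ≟ lowest f)) (does (t ≟ highest f)) (termOf (slice f t) a)
  termOf-∷ʳ {a} {t} p i j =
    trans (cong (λ P → P i j) (term-cong
      (count λ u v → u ∧ not v) (count λ u v → v ∧ not u) (count _∧_)))
    (term-activity (does (t ≟ lowest f)) (does (t ≟ highest f)) _ _ _ i j)
    where
    term-cong : ∀ {α α′ β β′ γ γ′} → α ≡ α′ → β ≡ β′ → γ ≡ γ′ → term α β γ ≡ term α′ β′ γ′
    term-cong refl refl refl = refl
    count : (_⊙_ : Bool → Bool → Bool) →
      countFin (λ k → intActive f (a ∷ʳ t) k ⊙ extActive f (a ∷ʳ t) k) ≡
      bit (does (t ≟ lowest f) ⊙ does (t ≟ highest f)) ℕ.+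
      countFin (λ k → intActive (slice f t) a k ⊙ extActive (slice f t) a k)
    count _⊙_ = trans (countFin-last λ k → intActive f (a ∷ʳ t) k ⊙ extActive f (a ∷ʳ t) k) (cong₂ ℕ._+_
      (cong bit (cong₂ _⊙_ (intActive-last p) (extActive-last p)))
      (length-filterᵇ-cong (List.allFin n) λ k →
        cong₂ _⊙_ (intActive-inject₁ a lo k) (extActive-inject₁ a lo k)))
      where lo = proj₁ (InP-bounds p)

-- Sums over the points of a polymatroid

rangeℤ-≤ : ∀ {l h} → l ≤ℤ h → rangeℤ l h ≡ List.map (λ t → l + + t) (upTo (suc ℤ.∣ h - l ∣))
rangeℤ-≤ l≤h rewrite Equivalence.to Bool.T-≡ (≤⇒≤ᵇ l≤h) = refl

+∣-∣ : ∀ {i j} → i ≤ℤ j → + ℤ.∣ j - i ∣ ≡ j - i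
+∣-∣ = 0≤i⇒+∣i∣≡i ∘ i≤j⇒0≤j-i

∈-rangeℤ⁺ : ∀ {l h x} → l ≤ℤ x → x ≤ℤ h → x ∈ˡ rangeℤ l h
∈-rangeℤ⁺ {l} {h} {x} l≤x x≤h rewrite rangeℤ-≤ (≤-trans l≤x x≤h) =
  subst (_∈ˡ List.map (λ t → l + + t) (upTo (suc ℤ.∣ h - l ∣)))
    (trans (cong (_+_ l) (+∣-∣ l≤x)) (lemma l x))
    (∈-map⁺ _ (∈-upTo⁺ (ℕ.s≤s (drop‿+≤+
      (subst₂ _≤ℤ_ (sym (+∣-∣ l≤x)) (sym (+∣-∣ (≤-trans l≤x x≤h))) (+-monoˡ-≤ (- l) x≤h))))))
  where
  lemma : ∀ l x → l + (x - l) ≡ x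
  lemma = solve-∀

∈-rangeℤ⁻ : ∀ {l h x} → l ≤ℤ h → x ∈ˡ rangeℤ l h → l ≤ℤ x × x ≤ℤ h
∈-rangeℤ⁻ {l} {h} {x} l≤h x∈ with ∈-map⁻ (λ t → l + + t) (subst (x ∈ˡ_) (rangeℤ-≤ l≤h) x∈)
... | t , t∈ , refl = i≤i+j l (+ t) , subst (l + + t ≤ℤ_) (lemma l h)
  (+-monoʳ-≤ l (subst (+ t ≤ℤ_) (+∣-∣ l≤h) (ℤ.+≤+ (ℕ.s≤s⁻¹ (∈-upTo⁻ t∈)))))
  where
  lemma : ∀ l h → l + (h - l) ≡ h
  lemma = solve-∀

rangeℤ-unique : ∀ l h → Unique (rangeℤ l h)
rangeℤ-unique l h with l ≤ᵇ h
... | true  = Unique.map⁺ (λ e → +-injective (∙-cancelˡ +-0-abelianGroup l _ _ e)) (Unique.upTo⁺ (suc ℤ.∣ h - l ∣))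
... | false = []

length-rangeℤ : ∀ {l h} → l ≤ℤ h → + length (rangeℤ l h) ≡ h - l + 1ℤ
length-rangeℤ {l} {h} l≤h rewrite rangeℤ-≤ l≤h =
  trans (cong +_ (trans (length-map (λ t → l + + t) (upTo (suc ℤ.∣ h - l ∣))) (length-upTo (suc ℤ.∣ h - l ∣))))
  (trans (+-comm 1ℤ (+ ℤ.∣ h - l ∣)) (cong (_+ 1ℤ) (+∣-∣ l≤h)))

concatMap-unique : ∀ {h : A → List B} → (∀ x → Unique (h x)) →
  (∀ {x y v} → v ∈ˡ h x → v ∈ˡ h y → x ≡ y) → ∀ {xs} → Unique xs → Unique (concatMap h xs)
concatMap-unique h! disjoint []         = []
concatMap-unique {h = h} h! disjoint {x ∷ xs} (x∉ ∷ xs!) =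
  Unique.++⁺ (h! x) (concatMap-unique h! disjoint xs!) λ (v∈x , v∈xs) →
    let y , y∈ , v∈y = find (∈-concatMap⁻ h v∈xs) in
    All.lookup x∉ y∈ (disjoint v∈x v∈y)

box-unique : ∀ (l h : Vec ℤ n) → Unique (box l h)
box-unique []      []      = All.[] ∷ []
box-unique (l ∷ lo) (h ∷ hi) = concatMap-unique
  (λ x → Unique.map⁺ Vec.∷-injectiveʳ (box-unique lo hi))
  (λ v∈x v∈y → head≡ (∈-map⁻ _ v∈x) (∈-map⁻ _ v∈y))
  (rangeℤ-unique l h)
  where
  head≡ : ∀ {x y} {v : Vec ℤ (suc n)} {xs ys : List (Vec ℤ n)} →
    (∃ λ a → a ∈ˡ xs × v ≡ x ∷ a) → (∃ λ a → a ∈ˡ ys × v ≡ y ∷ a) → x ≡ y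
  head≡ (_ , _ , refl) (_ , _ , refl) = refl

∈-box : ∀ (l h a : Vec ℤ n) →
  (∀ i → lookup l i ≤ℤ lookup a i × lookup a i ≤ℤ lookup h i) → a ∈ˡ box l h
∈-box []      []      []      bounds = here refl
∈-box (l ∷ lo) (h ∷ hi) (x ∷ a) bounds = ∈-concatMap⁺ _
  (Any.map (λ { refl → ∈-map⁺ _ (∈-box lo hi a (bounds ∘ suc)) })
    (∈-rangeℤ⁺ (proj₁ (bounds zero)) (proj₂ (bounds zero))))

lowerBounds upperBounds : (Subset n → ℤ) → Vec ℤ n
lowerBounds f = Vec.map (λ i → f ⊤ - f (∁ ⁅ i ⁆)) (Vec.allFin _)
upperBounds f = Vec.map (λ i → f ⁅ i ⁆) (Vec.allFin _)

pointsOf-unique : ∀ (f : Subset n → ℤ) → Unique (pointsOf f)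
pointsOf-unique f =
  Unique.filter⁺ (Bool.T? ∘ inP f) (box-unique (lowerBounds f) (upperBounds f))

∈-pointsOf⁻ : ∀ (f : Subset n → ℤ) {a} → a ∈ˡ pointsOf f → InP f a
∈-pointsOf⁻ f a∈ = inP⇒InP (Equivalence.to Bool.T-≡ (proj₂
  (∈-filter⁻ (Bool.T? ∘ inP f) {xs = box (lowerBounds f) (upperBounds f)} a∈)))

∈-pointsOf⁺ : ∀ (f : Subset n → ℤ) {a} → InP f a → a ∈ˡ pointsOf f
∈-pointsOf⁺ f {a} p@(below , total) = ∈-filter⁺ (Bool.T? ∘ inP f)
  (∈-box (lowerBounds f) (upperBounds f) a bounds) (Equivalence.from Bool.T-≡ (InP⇒inP p))
  where
  bounds : ∀ i → lookup (lowerBounds f) i ≤ℤ lookup a i × lookup a i ≤ℤ lookup (upperBounds f) i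
  bounds i
    rewrite Vec.lookup-map i (λ i → f ⊤ - f (∁ ⁅ i ⁆)) (Vec.allFin _)
          | Vec.lookup-map i (λ i → f ⁅ i ⁆) (Vec.allFin _)
          | Vec.lookup-allFin i
          | sym (sumOn-⁅⁆ i a)
          | sym total
          | sym (sumOn-∁ ⁅ i ⁆ a) =
      -- After the rewrites f ⊤ is the i-th coordinate plus the sum over the complement, so the
      -- lower bound is the inequality for that complement.
      ≤-by (lemma (sumOn ⁅ i ⁆ a) (sumOn (∁ ⁅ i ⁆) a) (f (∁ ⁅ i ⁆))) (i≤j⇒0≤j-i (below (∁ ⁅ i ⁆)))
    , below ⁅ i ⁆
    where
    lemma : ∀ x y z → x - (x + y - z) ≡ z - y
    lemma = solve-∀

-- Through this description of P the sum over its points can be sliced without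
-- comparing the boxes used to enumerate P and its slices.
pointsOf-↭ : ∀ (f : Subset n → ℤ) {xs} → Unique xs → (∀ {a} → a ∈ˡ xs → InP f a) →
  (∀ {a} → InP f a → a ∈ˡ xs) → pointsOf f ↭ xs
pointsOf-↭ f xs! sound complete = ∼bag⇒↭ (unique∧set⇒bag (pointsOf-unique f) xs!
  (mk⇔ (complete ∘ ∈-pointsOf⁻ f) (∈-pointsOf⁺ f ∘ sound)))

∑-indicator : ∀ {c} (g : ℤ → ℤ) {xs} → Unique xs → c ∈ˡ xs →
  ∑ xs (λ t → ⟦ does (t ≟ c) ⟧ * g t) ≡ g c
∑-indicator {c} g {x ∷ xs} (x∉ ∷ xs!) (here refl) with c ≟ c
... | no c≢c = contradiction refl c≢c
... | yes _  = trans (cong₂ _+_ (*-identityˡ (g c))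
    (trans (∑-cong-∈ xs λ {t} t∈ → vanish t (All.lookup x∉ t∈)) (∑-zero xs)))
  (+-identityʳ (g c))
  where
  vanish : ∀ t → c ≢ t → ⟦ does (t ≟ c) ⟧ * g t ≡ 0ℤ
  vanish t c≢t with t ≟ c
  ... | yes t≡c = contradiction (sym t≡c) c≢t
  ... | no _    = *-zeroˡ (g t)
∑-indicator {c} g {x ∷ xs} (x∉ ∷ xs!) (there c∈) with x ≟ c
... | yes x≡c = contradiction x≡c (All.lookup x∉ c∈)
... | no _    = trans (cong₂ _+_ (*-zeroˡ (g x)) (∑-indicator g xs! c∈)) (+-identityˡ (g c))

𝒯-∑ : ∀ (f : Subset n → ℤ) i j → 𝒯 f i j ≡ ∑ (pointsOf f) (λ a → termOf f a i j)
𝒯-∑ f i j = go (pointsOf f)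
  where
  zeroP≡0 : ∀ i j → zeroP i j ≡ 0ℤ
  zeroP≡0 zero    zero    = refl
  zeroP≡0 zero    (suc j) = refl
  zeroP≡0 (suc i) j       = refl
  go : ∀ xs → List.foldr _⊕_ zeroP (List.map (termOf f) xs) i j ≡ ∑ xs (λ a → termOf f a i j)
  go []       = zeroP≡0 i j
  go (x ∷ xs) = cong (_+_ (termOf f x i j)) (go xs)

∑-timesActivity : ∀ (f : Subset n → ℤ) p q i j →
  ∑ (pointsOf f) (λ a → timesActivity p q (termOf f a) i j) ≡ timesActivity p q (𝒯 f) i j
∑-timesActivity f p q i j = begin
  ∑ xs (λ a → ⟦ p ⟧ * x a + ⟦ q ⟧ * y a + r * z a)
    ≡⟨ ∑-+ (λ a → ⟦ p ⟧ * x a + ⟦ q ⟧ * y a) (λ a → r * z a) xs ⟩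
  ∑ xs (λ a → ⟦ p ⟧ * x a + ⟦ q ⟧ * y a) + ∑ xs (λ a → r * z a)
    ≡⟨ cong₂ _+_ (∑-+ (λ a → ⟦ p ⟧ * x a) (λ a → ⟦ q ⟧ * y a) xs) (∑-*ˡ r z xs) ⟩
  ∑ xs (λ a → ⟦ p ⟧ * x a) + ∑ xs (λ a → ⟦ q ⟧ * y a) + r * ∑ xs z
    ≡⟨ cong₂ (λ u v → u + v + r * ∑ xs z) (∑-*ˡ ⟦ p ⟧ x xs) (∑-*ˡ ⟦ q ⟧ y xs) ⟩
  ⟦ p ⟧ * ∑ xs x + ⟦ q ⟧ * ∑ xs y + r * ∑ xs z
    ≡⟨ cong₂ _+_ (cong₂ (λ u v → ⟦ p ⟧ * u + ⟦ q ⟧ * v) (∑-timesX i) (∑-timesY j)) (cong (_*_ r) (sym (𝒯-∑ f i j))) ⟩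
  timesActivity p q (𝒯 f) i j ∎
  where
  open ≡-Reasoning
  xs = pointsOf f
  r = 1ℤ - ⟦ p ⟧ - ⟦ q ⟧
  x = λ a → timesX (termOf f a) i j
  y = λ a → timesY (termOf f a) i j
  z = λ a → termOf f a i j
  ∑-timesX : ∀ i → ∑ xs (λ a → timesX (termOf f a) i j) ≡ timesX (𝒯 f) i j
  ∑-timesX zero    = ∑-zero xs
  ∑-timesX (suc i) = sym (𝒯-∑ f i j)
  ∑-timesY : ∀ j → ∑ xs (λ a → timesY (termOf f a) i j) ≡ timesY (𝒯 f) i j
  ∑-timesY zero    = ∑-zero xs
  ∑-timesY (suc j) = sym (𝒯-∑ f i j)

module _ (f : Subset (suc n) → ℤ) (f⊥ : f ⊥ ≡ 0ℤ) (f-submodular : Submodular f) where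
  open Slice f f⊥ f-submodular

  private
    range = rangeℤ (lowest f) (highest f)
    range! = rangeℤ-unique (lowest f) (highest f)

  pointsOf-slices : pointsOf f ↭ concatMap (λ t → List.map (_∷ʳ t) (pointsOf (slice f t))) range
  pointsOf-slices = pointsOf-↭ f
    (concatMap-unique (λ t → Unique.map⁺ (Vec.∷ʳ-injectiveˡ _ _) (pointsOf-unique (slice f t)))
      (λ v∈s v∈t → last≡ (∈-map⁻ _ v∈s) (∈-map⁻ _ v∈t))
      range!)
    (λ a∈ → let t , t∈ , v∈ = find (∈-concatMap⁻ _ a∈)
                a , a∈′ , eq = ∈-map⁻ (_∷ʳ t) v∈
            in subst (InP f) (sym eq)
                 (InP-slice⁻ (proj₁ (∈-rangeℤ⁻ lowest≤highest t∈)) (∈-pointsOf⁻ (slice f t) a∈′)))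
    (λ {a} → ∷ʳ-elim
      (λ a → InP f a → a ∈ˡ concatMap (λ t → List.map (_∷ʳ t) (pointsOf (slice f t))) range)
      (λ a t p → ∈-concatMap⁺ _ (lose
        (∈-rangeℤ⁺ (proj₁ (InP-bounds p)) (proj₂ (InP-bounds p)))
        (∈-map⁺ (_∷ʳ t) (∈-pointsOf⁺ (slice f t) (InP-slice⁺ p)))))
      a)
    where
    last≡ : ∀ {s t} {v : Vec ℤ (suc n)} {xs ys : List (Vec ℤ n)} →
      (∃ λ a → a ∈ˡ xs × v ≡ a ∷ʳ s) → (∃ λ a → a ∈ˡ ys × v ≡ a ∷ʳ t) → s ≡ t
    last≡ (a , _ , refl) (b , _ , eq) = Vec.∷ʳ-injectiveʳ a b eq

  𝒯-slices : ∀ i j → 𝒯 f i j ≡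
    ∑ range (λ t → timesActivity (does (t ≟ lowest f)) (does (t ≟ highest f)) (𝒯 (slice f t)) i j)
  𝒯-slices i j = trans (𝒯-∑ f i j)
    (trans (∑-↭ (λ a → termOf f a i j) pointsOf-slices)
    (trans (∑-concatMap (λ a → termOf f a i j) (λ t → List.map (_∷ʳ t) (pointsOf (slice f t))) range)
      (∑-cong-∈ range λ {t} t∈ →
        trans (∑-map (λ a → termOf f a i j) (_∷ʳ t) (pointsOf (slice f t)))
        (trans (∑-cong-∈ (pointsOf (slice f t)) λ a∈ → termOf-∷ʳ
            (InP-slice⁻ (proj₁ (∈-rangeℤ⁻ lowest≤highest t∈)) (∈-pointsOf⁻ (slice f t) a∈)) i j)
          (∑-timesActivity (slice f t) (does (t ≟ lowest f)) (does (t ≟ highest f)) i j)))))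

  -- When all slices share the coefficient c, only the shifted end slices enter individually. The
  -- weights 1 - [t = m] - [t = M] over M - m + 1 values of t sum to M - m - 1. For m = M this is
  -- -1, in accordance with the factor x + y - 1 of the single slice.
  𝒯-constant-slices : ∀ i j c →
    (∀ {t} → lowest f ≤ℤ t → t ≤ℤ highest f → 𝒯 (slice f t) i j ≡ c) →
    𝒯 f i j ≡ timesX (𝒯 (slice f (lowest f))) i j + timesY (𝒯 (slice f (highest f))) i j
              + (highest f - lowest f - 1ℤ) * c
  𝒯-constant-slices i j c const = begin
    𝒯 f i j
      ≡⟨ 𝒯-slices i j ⟩
    ∑ range (λ t → p t * x t + q t * y t + (1ℤ - p t - q t) * 𝒯 (slice f t) i j)
      ≡⟨ ∑-cong-∈ range (λ {t} t∈ → trans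
           (cong (λ z → p t * x t + q t * y t + (1ℤ - p t - q t) * z)
             (const (proj₁ (∈-rangeℤ⁻ lowest≤highest t∈)) (proj₂ (∈-rangeℤ⁻ lowest≤highest t∈))))
           (rearrange (p t) (q t) (x t) (y t) c)) ⟩
    -- With the indicators collected, each end is picked out once and the bare c is counted once per
    -- t.
    ∑ range (λ t → p t * (x t - c) + q t * (y t - c) + c)
      ≡⟨ trans (∑-+ (λ t → p t * (x t - c) + q t * (y t - c)) (λ _ → c) range)
           (cong (_+ ∑ range (λ _ → c)) (∑-+ (λ t → p t * (x t - c)) (λ t → q t * (y t - c)) range)) ⟩
    ∑ range (λ t → p t * (x t - c)) + ∑ range (λ t → q t * (y t - c)) + ∑ range (λ _ → c)
      ≡⟨ cong₂ _+_
           (cong₂ _+_ (∑-indicator (λ t → x t - c) range! (∈-rangeℤ⁺ ≤-refl lowest≤highest))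
                      (∑-indicator (λ t → y t - c) range! (∈-rangeℤ⁺ lowest≤highest ≤-refl)))
           (trans (∑-const c range) (cong (_* c) (length-rangeℤ lowest≤highest))) ⟩
    x (lowest f) - c + (y (highest f) - c) + (highest f - lowest f + 1ℤ) * c
      ≡⟨ collect (x (lowest f)) (y (highest f)) c (lowest f) (highest f) ⟩
    x (lowest f) + y (highest f) + (highest f - lowest f - 1ℤ) * c ∎
    where
    open ≡-Reasoning
    p q x y : ℤ → ℤ
    p t = ⟦ does (t ≟ lowest f) ⟧
    q t = ⟦ does (t ≟ highest f) ⟧
    x t = timesX (𝒯 (slice f t)) i j
    y t = timesY (𝒯 (slice f t)) i j
    rearrange : ∀ p q x y c →
      p * x + q * y + (1ℤ - p - q) * c ≡ p * (x - c) + q * (y - c) + c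
    rearrange = solve-∀
    collect : ∀ x y c l h → x - c + (y - c) + (h - l + 1ℤ) * c ≡ x + y + (h - l - 1ℤ) * c
    collect = solve-∀

-- Sums over the subsets of a given size

∑-filterᵇ : ∀ {A : Set} (p : A → Bool) (g : A → ℤ) xs →
  ∑ (filterᵇ p xs) g ≡ ∑ xs (λ x → ⟦ p x ⟧ * g x)
∑-filterᵇ p g []       = refl
∑-filterᵇ p g (x ∷ xs) with p x
... | true  = cong₂ _+_ (sym (*-identityˡ (g x))) (∑-filterᵇ p g xs)
... | false = trans (∑-filterᵇ p g xs)
  (sym (trans (cong (_+ ∑ xs (λ y → ⟦ p y ⟧ * g y)) (*-zeroˡ (g x))) (+-identityˡ _)))

∑-allSubsets-∷ : ∀ (h : Subset (suc n) → ℤ) → ∑ (allSubsets (suc n)) h ≡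
  ∑ (allSubsets n) (λ S → h (true ∷ S)) + ∑ (allSubsets n) (λ S → h (false ∷ S))
∑-allSubsets-∷ {n} h = trans
  (∑-concatMap h (λ S → (true ∷ S) ∷ (false ∷ S) ∷ []) (allSubsets n))
  (trans (∑-cong (allSubsets n) λ S → cong (_+_ (h (true ∷ S))) (+-identityʳ (h (false ∷ S))))
         (∑-+ (λ S → h (true ∷ S)) (λ S → h (false ∷ S)) (allSubsets n)))

-- `allSubsets` branches on the first element while the slices remove the last one, so the sum is
-- split at both ends and the four parts are regrouped.
∑-allSubsets-∷ʳ : ∀ n (h : Subset (suc n) → ℤ) → ∑ (allSubsets (suc n)) h ≡
  ∑ (allSubsets n) (λ S → h (S ∷ʳ true)) + ∑ (allSubsets n) (λ S → h (S ∷ʳ false))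
∑-allSubsets-∷ʳ zero    h = ∑-allSubsets-∷ h
∑-allSubsets-∷ʳ (suc n) h = begin
  ∑ (allSubsets (suc (suc n))) h
    ≡⟨ ∑-allSubsets-∷ h ⟩
  ∑ (allSubsets (suc n)) (λ S → h (true ∷ S)) + ∑ (allSubsets (suc n)) (λ S → h (false ∷ S))
    ≡⟨ cong₂ _+_ (∑-allSubsets-∷ʳ n (λ S → h (true ∷ S))) (∑-allSubsets-∷ʳ n (λ S → h (false ∷ S))) ⟩
  s true true + s true false + (s false true + s false false)
    ≡⟨ interchange (s true true) (s true false) (s false true) (s false false) ⟩
  s true true + s false true + (s true false + s false false)
    ≡⟨ cong₂ _+_ (∑-allSubsets-∷ (λ S → h (S ∷ʳ true))) (∑-allSubsets-∷ (λ S → h (S ∷ʳ false))) ⟨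
  ∑ (allSubsets (suc n)) (λ S → h (S ∷ʳ true)) + ∑ (allSubsets (suc n)) (λ S → h (S ∷ʳ false)) ∎
  where
  open ≡-Reasoning
  s : Bool → Bool → ℤ
  s b c = ∑ (allSubsets n) (λ S → h (b ∷ (S ∷ʳ c)))
  interchange : ∀ a b c d → a + b + (c + d) ≡ a + c + (b + d)
  interchange = solve-∀

∣∷ʳ-true∣ : ∀ (S : Subset n) → ∣ S ∷ʳ true ∣ ≡ suc ∣ S ∣
∣∷ʳ-true∣ []          = refl
∣∷ʳ-true∣ (true ∷ S)  = cong suc (∣∷ʳ-true∣ S)
∣∷ʳ-true∣ (false ∷ S) = ∣∷ʳ-true∣ S

∣∷ʳ-false∣ : ∀ (S : Subset n) → ∣ S ∷ʳ false ∣ ≡ ∣ S ∣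
∣∷ʳ-false∣ []          = refl
∣∷ʳ-false∣ (true ∷ S)  = cong suc (∣∷ʳ-false∣ S)
∣∷ʳ-false∣ (false ∷ S) = ∣∷ʳ-false∣ S

σ : ℕ → (Subset n → ℤ) → ℤ
σ = sumOverSubsetsOfSize

ofSize : ℕ → Subset n → ℤ
ofSize k S = ⟦ does (∣ S ∣ ℕ.≟ k) ⟧

σ-∑ : ∀ k (f : Subset n → ℤ) → σ k f ≡ ∑ (allSubsets n) (λ S → ofSize k S * f S)
σ-∑ k f = ∑-filterᵇ (λ S → does (∣ S ∣ ℕ.≟ k)) f (allSubsets _)

σ-cong : ∀ k {f g : Subset n → ℤ} → (∀ S → f S ≡ g S) → σ k f ≡ σ k g
σ-cong k e = ∑-cong (filterᵇ (λ S → does (∣ S ∣ ℕ.≟ k)) (allSubsets _)) e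

σ-zero-∷ʳ : ∀ (f : Subset (suc n) → ℤ) → σ 0 f ≡ σ 0 (λ S → f (S ∷ʳ false))
σ-zero-∷ʳ {n} f = trans (σ-∑ 0 f) (trans (∑-allSubsets-∷ʳ n (λ S → ofSize 0 S * f S))
  (trans (cong₂ _+_
    (trans (∑-cong (allSubsets n) λ S → trans
        (cong (λ m → ⟦ does (m ℕ.≟ 0) ⟧ * f (S ∷ʳ true)) (∣∷ʳ-true∣ S)) (*-zeroˡ (f (S ∷ʳ true))))
      (∑-zero (allSubsets n)))
    (∑-cong (allSubsets n) λ S → cong (λ m → ⟦ does (m ℕ.≟ 0) ⟧ * f (S ∷ʳ false)) (∣∷ʳ-false∣ S)))
  (trans (+-identityˡ _) (sym (σ-∑ 0 (λ S → f (S ∷ʳ false)))))))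

σ-suc-∷ʳ : ∀ k (f : Subset (suc n) → ℤ) →
  σ (suc k) f ≡ σ k (λ S → f (S ∷ʳ true)) + σ (suc k) (λ S → f (S ∷ʳ false))
σ-suc-∷ʳ {n} k f = trans (σ-∑ (suc k) f) (trans (∑-allSubsets-∷ʳ n (λ S → ofSize (suc k) S * f S))
  (cong₂ _+_
    (trans (∑-cong (allSubsets n) λ S →
              cong (λ m → ⟦ does (m ℕ.≟ suc k) ⟧ * f (S ∷ʳ true)) (∣∷ʳ-true∣ S))
           (sym (σ-∑ k (λ S → f (S ∷ʳ true)))))
    (trans (∑-cong (allSubsets n) λ S →
              cong (λ m → ⟦ does (m ℕ.≟ suc k) ⟧ * f (S ∷ʳ false)) (∣∷ʳ-false∣ S))
           (sym (σ-∑ (suc k) (λ S → f (S ∷ʳ false)))))))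

pascal : ∀ n k → + (suc n C suc k) ≡ + (n C k) + + (n C suc k)
pascal n k = cong +_ (sym (nCk+nC[k+1]≡[n+1]C[k+1] n k))

σ-const : ∀ n k c → σ k (λ (_ : Subset n) → c) ≡ + (n C k) * c
σ-const zero    zero    c = trans (+-identityʳ c) (sym (*-identityˡ c))
σ-const zero    (suc k) c = refl
σ-const (suc n) zero    c = trans (σ-zero-∷ʳ (λ (_ : Subset (suc n)) → c)) (σ-const n zero c)
σ-const (suc n) (suc k) c = trans (σ-suc-∷ʳ k (λ (_ : Subset (suc n)) → c))
  (trans (cong₂ _+_ (σ-const n k c) (σ-const n (suc k) c))
  (trans (sym (*-distribʳ-+ c (+ (n C k)) (+ (n C suc k)))) (cong (_* c) (sym (pascal n k)))))

σ-shift : ∀ k (f : Subset n → ℤ) c → σ k (λ S → f S - c) ≡ σ k f - + (n C k) * c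
σ-shift {n} k f c = trans (∑-+ f (λ _ → - c) (filterᵇ (λ S → does (∣ S ∣ ℕ.≟ k)) (allSubsets n)))
  (cong (_+_ (σ k f)) (trans (σ-const n k (- c)) (sym (neg-distribʳ-* (+ (n C k)) c))))

σ-large : ∀ {k} (f : Subset n → ℤ) → n ℕ.< k → σ k f ≡ 0ℤ
σ-large {zero}  {suc k} f _ = refl
σ-large {suc n} {suc k} f (ℕ.s≤s n<k) = trans (σ-suc-∷ʳ k f)
  (cong₂ _+_ (σ-large (λ S → f (S ∷ʳ true)) n<k)
             (σ-large (λ S → f (S ∷ʳ false)) (ℕ.m<n⇒m<1+n n<k)))

σ-full : ∀ (f : Subset n → ℤ) → σ n f ≡ f ⊤
σ-full {zero}  f = +-identityʳ (f [])
σ-full {suc n} f = trans (σ-suc-∷ʳ n f)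
  (trans (cong₂ _+_ (σ-full (λ S → f (S ∷ʳ true))) (σ-large (λ S → f (S ∷ʳ false)) ℕ.≤-refl))
  (trans (+-identityʳ _) (cong f (sym (⊤-∷ʳ n)))))

-- The right-hand side of the theorem for k = suc j.
subleading : (Subset n → ℤ) → ℕ → ℤ
subleading {n} f j = σ j f + σ (suc j) f - + (n C j) * f ⊤ - + (suc j *ℕ (n C suc j))

subleading-cong : ∀ {f g : Subset n → ℤ} → (∀ S → f S ≡ g S) → ∀ j → subleading f j ≡ subleading g j
subleading-cong {n} e j = cong₂ (λ s t → s - + (n C j) * t - + (suc j *ℕ (n C suc j)))
  (cong₂ _+_ (σ-cong j e) (σ-cong (suc j) e)) (e ⊤)

-- The boundary value for exponent 0 of x, where the slice at `lowest f`, shifted by x, has no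
-- coefficient.
subleading-full : ∀ (f : Subset n → ℤ) → subleading f n ≡ 0ℤ
subleading-full {n} f
  rewrite σ-full f | σ-large f (ℕ.n<1+n n) | nCn≡1 n | k>n⇒nCk≡0 (ℕ.n<1+n n) | ℕ.*-zeroʳ n =
  lemma (f ⊤)
  where
  lemma : ∀ x → x + 0ℤ - 1ℤ * x - 0ℤ ≡ 0ℤ
  lemma = solve-∀

-- In y-degree 0 the slice at `highest f` is absent. The factor of the last summand arises from
-- three places: the singleton of the last element gives `highest f`, passing from the rank of the
-- whole set to that of the earlier elements gives minus `lowest f`, and the growth of the binomial
-- gives -1.
subleading-zero : ∀ (f : Subset (suc n) → ℤ) → subleading f 0 ≡
  subleading (λ S → f (S ∷ʳ false)) 0 + (highest f - lowest f - 1ℤ) * + (n C 0)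
subleading-zero {n} f = begin
  σ 0 f + σ 1 f - + (suc n C 0) * f ⊤ - + (1 *ℕ (suc n C 1))
    ≡⟨ cong₂ _-_
        (cong₂ _-_
          (cong₂ _+_ (σ-zero-∷ʳ f)
            (trans (σ-suc-∷ʳ 0 f) (cong (_+ σ 1 f₀) (σ-bottom f₁))))
          (cong (λ I → 1ℤ * f I) (⊤-∷ʳ n)))
        (trans (cong +_ (ℕ.*-identityˡ (suc n C 1))) (pascal n 0)) ⟩
  σ 0 f₀ + (f₁ ⊥ + σ 1 f₀) - 1ℤ * f₁ ⊤ - (1ℤ + + (n C 1))
    ≡⟨ rearrange (σ 0 f₀) (f₁ ⊥) (σ 1 f₀) (f₁ ⊤) (f₀ ⊤) (+ (n C 1)) ⟩
  σ 0 f₀ + σ 1 f₀ - 1ℤ * f₀ ⊤ - + (n C 1) + (f₁ ⊥ - (f₁ ⊤ - f₀ ⊤) - 1ℤ) * 1ℤ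
    ≡⟨ cong (λ m → σ 0 f₀ + σ 1 f₀ - 1ℤ * f₀ ⊤ - + m + (f₁ ⊥ - (f₁ ⊤ - f₀ ⊤) - 1ℤ) * 1ℤ)
         (ℕ.*-identityˡ (n C 1)) ⟨
  subleading f₀ 0 + (highest f - lowest f - 1ℤ) * + (n C 0) ∎
  where
  open ≡-Reasoning
  f₀ f₁ : Subset n → ℤ
  f₀ S = f (S ∷ʳ false)
  f₁ S = f (S ∷ʳ true)
  σ-bottom : ∀ {n} (g : Subset n → ℤ) → σ 0 g ≡ g ⊥
  σ-bottom {zero}  g = +-identityʳ (g [])
  σ-bottom {suc n} g = trans (σ-zero-∷ʳ g)
    (trans (σ-bottom (λ S → g (S ∷ʳ false))) (cong g (sym (⊥-∷ʳ n))))
  rearrange : ∀ a h s x y c →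
    a + (h + s) - 1ℤ * x - (1ℤ + c) ≡ a + s - 1ℤ * y - c + (h - (x - y) - 1ℤ) * 1ℤ
  rearrange = solve-∀

-- Sets split by whether they contain the last element, binomials by Pascal's rule. The shift by
-- `highest f` occurs in both subset sums and in the rank of `⊤`; it leaves minus `highest f` times
-- `n C suc j`, which the last summand cancels. The -1 there comes from writing j + 2 as (j + 1) + 1
-- in front of `n C suc j`.
subleading-suc : ∀ (f : Subset (suc n) → ℤ) j → subleading f (suc j) ≡
  subleading (λ S → f (S ∷ʳ false)) (suc j) + subleading (λ S → f (S ∷ʳ true) - highest f) j
    + (highest f - lowest f - 1ℤ) * + (n C suc j)
subleading-suc {n} f j = begin
  σ (suc j) f + σ (suc (suc j)) f - + (suc n C suc j) * f ⊤ - + (suc (suc j) *ℕ (suc n C suc (suc j)))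
    ≡⟨ cong₂ _-_
        (cong₂ _-_ (cong₂ _+_ (σ-suc-∷ʳ j f) (σ-suc-∷ʳ (suc j) f))
          (cong₂ _*_ (pascal n j) (cong f (⊤-∷ʳ n))))
        (trans (pos-* (suc (suc j)) (suc n C suc (suc j))) (cong (_*_ (+ suc (suc j))) (pascal n (suc j)))) ⟩
  σ j f₁ + σ (suc j) f₀ + (σ (suc j) f₁ + σ (suc (suc j)) f₀) - (c + c′) * f₁ ⊤
    - + suc (suc j) * (c′ + c″)
    ≡⟨ rearrange (σ j f₁) (σ (suc j) f₁) (σ (suc j) f₀) (σ (suc (suc j)) f₀)
         c c′ c″ (f₁ ⊤) (f₀ ⊤) (highest f) (+ suc j) ⟩
  σ (suc j) f₀ + σ (suc (suc j)) f₀ - c′ * f₀ ⊤ - + suc (suc j) * c″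
    + (σ j f₁ - c * highest f + (σ (suc j) f₁ - c′ * highest f) - c * (f₁ ⊤ - highest f) - + suc j * c′)
    + (highest f - (f₁ ⊤ - f₀ ⊤) - 1ℤ) * c′
    ≡⟨ cong₂ (λ u v → u + v + (highest f - (f₁ ⊤ - f₀ ⊤) - 1ℤ) * c′)
        (cong (_-_ (σ (suc j) f₀ + σ (suc (suc j)) f₀ - c′ * f₀ ⊤)) (pos-* (suc (suc j)) (n C suc (suc j))))
        (cong₂ (λ u v → u - c * (f₁ ⊤ - highest f) - v)
          (cong₂ _+_ (σ-shift j f₁ (highest f)) (σ-shift (suc j) f₁ (highest f)))
          (pos-* (suc j) (n C suc j))) ⟨
  subleading f₀ (suc j) + subleading (λ S → f₁ S - highest f) j
    + (highest f - lowest f - 1ℤ) * + (n C suc j) ∎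
  where
  open ≡-Reasoning
  f₀ f₁ : Subset n → ℤ
  f₀ S = f (S ∷ʳ false)
  f₁ S = f (S ∷ʳ true)
  c c′ c″ : ℤ
  c  = + (n C j)
  c′ = + (n C suc j)
  c″ = + (n C suc (suc j))
  rearrange : ∀ u u′ v v′ c c′ c″ x y h k →
    u + v + (u′ + v′) - (c + c′) * x - (1ℤ + k) * (c′ + c″) ≡
    v + v′ - c′ * y - (1ℤ + k) * c″
      + (u - c * h + (u′ - c′ * h) - c * (x - h) - k * c′)
      + (h - (x - y) - 1ℤ) * c′
  rearrange = solve 11 (λ u u′ v v′ c c′ c″ x y h k →
    u :+ v :+ (u′ :+ v′) :- (c :+ c′) :* x :- (con 1ℤ :+ k) :* (c′ :+ c″) :=
    v :+ v′ :- c′ :* y :- (con 1ℤ :+ k) :* c″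
      :+ (u :- c :* h :+ (u′ :- c′ :* h) :- c :* (x :- h) :- k :* c′)
      :+ (h :- (x :- y) :- con 1ℤ) :* c′) refl
    where open +-*-Solver

-- Induction on the number of coordinates

𝒯-empty : ∀ (f : Subset 0 → ℤ) → f ⊥ ≡ 0ℤ → 𝒯 f ≐ oneP
𝒯-empty f f⊥ i j = trans (𝒯-∑ f i j)
  (trans (∑-↭ (λ a → termOf f a i j) only) (trans (+-identityʳ _) (term-unit 0 i j)))
  where
  only : pointsOf f ↭ [] ∷ []
  only = pointsOf-↭ f (All.[] ∷ [])
    (λ { (here refl) → (λ { [] → ≤-reflexive (sym f⊥) }) , sym f⊥ }) (λ { {[]} _ → here refl })

𝒯-degree : ∀ n (f : Subset n → ℤ) → f ⊥ ≡ 0ℤ → Submodular f →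
  ∀ i j → n ℕ.< i ℕ.+ j → 𝒯 f i j ≡ 0ℤ
𝒯-degree zero    f f⊥ f-sub zero    (suc j) n<i+j = 𝒯-empty f f⊥ 0 (suc j)
𝒯-degree zero    f f⊥ f-sub (suc i) j       n<i+j = 𝒯-empty f f⊥ (suc i) j
𝒯-degree (suc n) f f⊥ f-sub i j n<i+j = trans
  (𝒯-constant-slices f f⊥ f-sub i j 0ℤ λ lo hi → smaller hi i j (ℕ.<-trans (ℕ.n<1+n n) n<i+j))
  (cong₂ _+_ (cong₂ _+_ (X-part i n<i+j) (Y-part j n<i+j))
               (*-zeroʳ (highest f - lowest f - 1ℤ)))
  where
  open Slice f f⊥ f-sub
  smaller : ∀ {t} → t ≤ℤ highest f → ∀ i j → n ℕ.< i ℕ.+ j → 𝒯 (slice f t) i j ≡ 0ℤ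
  smaller hi = 𝒯-degree n (slice f _) (slice-⊥ hi) (slice-submodular _)
  X-part : ∀ i → suc n ℕ.< i ℕ.+ j → timesX (𝒯 (slice f (lowest f))) i j ≡ 0ℤ
  X-part zero    _  = refl
  X-part (suc i) lt = smaller lowest≤highest i j (ℕ.s<s⁻¹ lt)
  Y-part : ∀ j → suc n ℕ.< i ℕ.+ j → timesY (𝒯 (slice f (highest f))) i j ≡ 0ℤ
  Y-part zero    _  = refl
  Y-part (suc j) lt = smaller ≤-refl i j (ℕ.s<s⁻¹ (subst (suc n ℕ.<_) (ℕ.+-suc i j) lt))

-- In top degree the slices have no coefficient of their own, so c is 0; the two shifted end slices
-- contribute binomials that add up by Pascal's rule.
𝒯-leading : ∀ n (f : Subset n → ℤ) → f ⊥ ≡ 0ℤ → Submodular f →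
  ∀ i j → i ℕ.+ j ≡ n → 𝒯 f i j ≡ + (n C j)
𝒯-leading zero    f f⊥ f-sub zero zero refl = 𝒯-empty f f⊥ 0 0
𝒯-leading (suc n) f f⊥ f-sub i j i+j≡n = trans
  (𝒯-constant-slices f f⊥ f-sub i j 0ℤ λ lo hi →
    𝒯-degree n (slice f _) (slice-⊥ hi) (slice-submodular _) i j (ℕ.≤-reflexive (sym i+j≡n)))
  (trans (cong (_+_ (timesX (𝒯 (slice f (lowest f))) i j + timesY (𝒯 (slice f (highest f))) i j))
               (*-zeroʳ (highest f - lowest f - 1ℤ)))
         (trans (+-identityʳ _) (parts i j i+j≡n)))
  where
  open Slice f f⊥ f-sub
  smaller : ∀ {t} → t ≤ℤ highest f → ∀ i j → i ℕ.+ j ≡ n → 𝒯 (slice f t) i j ≡ + (n C j)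
  smaller hi = 𝒯-leading n (slice f _) (slice-⊥ hi) (slice-submodular _)
  X-part : ∀ i j → i ℕ.+ j ≡ suc n → timesX (𝒯 (slice f (lowest f))) i j ≡ + (n C j)
  X-part zero    j refl = cong +_ (sym (k>n⇒nCk≡0 (ℕ.n<1+n n)))
  X-part (suc i) j e    = smaller lowest≤highest i j (ℕ.suc-injective e)
  parts : ∀ i j → i ℕ.+ j ≡ suc n →
    timesX (𝒯 (slice f (lowest f))) i j + timesY (𝒯 (slice f (highest f))) i j ≡ + (suc n C j)
  parts i zero    e = trans (+-identityʳ _) (X-part i zero e)
  parts i (suc j) e = trans (+-comm (timesX (𝒯 (slice f (lowest f))) i (suc j)) _)
    (trans (cong₂ _+_ (smaller ≤-refl i j (ℕ.suc-injective (trans (sym (ℕ.+-suc i j)) e)))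
                      (X-part i (suc j) e))
           (sym (pascal n j)))

𝒯-subleading : ∀ n (f : Subset n → ℤ) → f ⊥ ≡ 0ℤ → Submodular f →
  ∀ i j → suc (i ℕ.+ j) ≡ n → 𝒯 f i j ≡ subleading f j
𝒯-subleading (suc n) f f⊥ f-sub i j 1+i+j≡n = trans
  -- Here i + j is the top degree of every slice, so their common coefficient is a binomial
  -- independent of t.
  (𝒯-constant-slices f f⊥ f-sub i j (+ (n C j)) λ lo hi →
    𝒯-leading n (slice f _) (slice-⊥ hi) (slice-submodular _) i j i+j≡n)
  (parts i j i+j≡n)
  where
  open Slice f f⊥ f-sub
  i+j≡n = ℕ.suc-injective 1+i+j≡n
  X-part : ∀ i j → i ℕ.+ j ≡ n →
    timesX (𝒯 (slice f (lowest f))) i j ≡ subleading (λ S → f (S ∷ʳ false)) j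
  X-part zero    j refl = sym (subleading-full (λ S → f (S ∷ʳ false)))
  X-part (suc i) j e    = trans
    (𝒯-subleading n (slice f _) (slice-⊥ lowest≤highest) (slice-submodular _) i j e)
    (subleading-cong slice-lowest j)
  parts : ∀ i j → i ℕ.+ j ≡ n →
    timesX (𝒯 (slice f (lowest f))) i j + timesY (𝒯 (slice f (highest f))) i j
      + (highest f - lowest f - 1ℤ) * + (n C j) ≡ subleading f j
  parts i zero    e = trans
    (cong (_+ (highest f - lowest f - 1ℤ) * + (n C 0)) (trans (+-identityʳ _) (X-part i zero e)))
    (sym (subleading-zero f))
  parts i (suc j) e = trans
    (cong (_+ (highest f - lowest f - 1ℤ) * + (n C suc j))
      (cong₂ _+_ (X-part i (suc j) e)
        (trans (𝒯-subleading n (slice f _) (slice-⊥ ≤-refl) (slice-submodular _) i j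
                 (trans (sym (ℕ.+-suc i j)) e))
               (subleading-cong slice-highest j))))
    (sym (subleading-suc f j))

theorem5p3 : (n : ℕ) (f : Subset n → ℤ) → f ⊥ ≡ + 0 → Submodular f →
    (k : ℕ) → 1 ≤ k → k ≤ n →
    coeff (n ∸ k) (k ∸ 1) (𝒯 f)
    ≡ sumOverSubsetsOfSize (k ∸ 1) f + sumOverSubsetsOfSize k f
    - (+ (n C (k ∸ 1))) * f ⊤ - + (k *ℕ (n C k))
theorem5p3 n f f⊥ f-submodular (suc j) _ k≤n =
  -- With k = j + 1 the exponents n - k and j add up to n - 1, one below the degree.
  𝒯-subleading n f f⊥ f-submodular (n ∸ suc j) j
    (trans (sym (ℕ.+-suc (n ∸ suc j) j)) (ℕ.m∸n+n≡m k≤n))
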